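{- Let $G$ be a forest (a finite undirected acyclic graph) and $L(G)$ its line graph. Then $h_{\mathcal{P}(\mathcal{B}_G)}(t)=h_{\mathcal{P}^{\square}(\mathcal{B}_{L(G)})}(t)$.
   Context: For a finite undirected graph $H$ with vertex set $V$, the graphical building set $\mathcal{B}_H$ is the set of nonempty $I\subseteq V$ such that the induced subgraph $H|_I$ is connected; it is a building set on $V$. The line graph $L(G)$ has vertex set $E(G)$, two edges being adjacent when they share an endpoint. In general, a building set on a finite set $X$ is a collection $\mathcal{B}$ of nonempty subsets of $X$ containing all singletons and closed under unions of intersecting members; $\mathcal{B}_{\max}$ denotes its inclusion-maximal elements. A nested collection is a subset $N\subseteq\mathcal{B}\setminus\mathcal{B}_{\max}$ whose members are pairwise nested or disjoint and such that no union of $k\ge2$ pairwise disjoint members lies in $\mathcal{B}$. An extended nested collection is a set $\{I_1,\dots,I_m,x_{i_1},\dots,x_{i_r}\}$ with $I_j\in\mathcal{B}$ (maximal elements allowed) and formal symbols $x_i$ ($i\in X$) such that the $I_j$ are pairwise nested or disjoint, no union of $k\ge2$ pairwise disjoint $I_j$'s lies in $\mathcal{B}$, and no $i_\ell$ lies in any $I_j$. The nestohedron $\mathcal{P}(\mathcal{B})$ is a simple polytope of dimension $d=|X|-|\mathcal{B}_{\max}|$ with $f_i$ ($i$-faces) equal to the number of nested collections of cardinality $d-i$; the extended nestohedron $\mathcal{P}^{\square}(\mathcal{B})$ is a simple polytope of dimension $|X|$ with $f_i$ equal to the number of extended nested collections of cardinality $|X|-i$; for $X=\varnothing$ both are a point.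 For a $d$-polytope, $f_P(t)=\sum_{i=0}^d f_it^i$ and $h_P$ is defined by $f_P(t)=h_P(t+1)$. -}

module Defs where

open import Data.Bool using (Bool; true; false; _∧_; _∨_; not; if_then_else_)
open import Data.Nat using (ℕ; zero; suc; _+_; _∸_; _<ᵇ_; _≡ᵇ_; _≤ᵇ_)
open import Data.Nat.Combinatorics using (_C_)
open import Data.Integer as ℤ using (ℤ; +_; -_)
open import Data.Fin using (Fin; zero; suc; toℕ; inject₁; fromℕ; _≟_)
open import Data.Fin.Subset using (Subset)
open import Data.Bool.ListAction using (all; any)
open import Data.List using (List; []; _∷_; length; map; filterᵇ; allFin; lookup; concatMap; foldr; upTo; _++_)
open import Data.Vec using (Vec; []; _∷_; tabulate; replicate; zipWith)
import Data.Vec as V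
open import Data.Product using (Σ; _×_; _,_; proj₁; proj₂)
open import Function.Definitions using (Injective)
open import Relation.Binary.PropositionalEquality using (_≡_)
open import Relation.Nullary using (¬_; ⌊_⌋)

Graph : ℕ → Set
Graph n = Fin n → Fin n → Bool

IsSimple : ∀ {n} → Graph n → Set
IsSimple {n} G = (∀ i j → G i j ≡ G j i) × (∀ i → G i i ≡ false)

Cycle : ∀ {n} → Graph n → Set
Cycle {n} G =
  Σ ℕ λ k → Σ (Fin (3 + k) → Fin n) λ c →
    Injective _≡_ _≡_ c
    × (∀ (i : Fin (2 + k)) → G (c (inject₁ i)) (c (suc i)) ≡ true)
    × (G (c (fromℕ (2 + k))) (c zero) ≡ true)

IsForest : ∀ {n} → Graph n → Set
IsForest G = IsSimple G × ¬ Cycle G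

edges : ∀ {n} → Graph n → List (Fin n × Fin n)
edges {n} G = concatMap (λ i → map (λ j → (i , j))
                 (filterᵇ (λ j → (toℕ i <ᵇ toℕ j) ∧ G i j) (allFin n))) (allFin n)

eqFin : ∀ {n} → Fin n → Fin n → Bool
eqFin a b = ⌊ a ≟ b ⌋

shareEnd : ∀ {n} → (Fin n × Fin n) → (Fin n × Fin n) → Bool
shareEnd (a , b) (c , d) = eqFin a c ∨ eqFin a d ∨ eqFin b c ∨ eqFin b d

lineGraph : ∀ {n} (G : Graph n) → Graph (length (edges G))
lineGraph G e f = not (eqFin e f) ∧ shareEnd (lookup (edges G) e) (lookup (edges G) f)

allSubsets : (n : ℕ) → List (Subset n)
allSubsets zero = [] ∷ []
allSubsets (suc n) = map (false ∷_) (allSubsets n) ++ map (true ∷_) (allSubsets n)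

-- all sub-lists (= all subsets of a duplicate-free list)
sublists : ∀ {A : Set} → List A → List (List A)
sublists [] = [] ∷ []
sublists (x ∷ xs) = sublists xs ++ map (x ∷_) (sublists xs)

countᵇ : ∀ {A : Set} → (A → Bool) → List A → ℕ
countᵇ p xs = length (filterᵇ p xs)

mem : ∀ {n} → Fin n → Subset n → Bool
mem i I = V.lookup I i

nonemptyᵇ : ∀ {n} → Subset n → Bool
nonemptyᵇ {n} I = any (λ i → mem i I) (allFin n)

_⊆ᵇ_ : ∀ {n} → Subset n → Subset n → Bool
_⊆ᵇ_ {n} I J = all (λ i → not (mem i I) ∨ mem i J) (allFin n)

_⊂ᵇ_ : ∀ {n} → Subset n → Subset n → Bool
I ⊂ᵇ J = (I ⊆ᵇ J) ∧ not (J ⊆ᵇ I)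

disjointᵇ : ∀ {n} → Subset n → Subset n → Bool
disjointᵇ {n} I J = all (λ i → not (mem i I ∧ mem i J)) (allFin n)

unionAll : ∀ {n} → List (Subset n) → Subset n
unionAll {n} = foldr (zipWith _∨_) (replicate n false)

singleton : ∀ {n} → Fin n → Subset n
singleton {n} u = tabulate (λ i → eqFin i u)

-- Connectedness of the induced subgraph H|_I
-- R ↦ R ∪ { w ∈ I | w adjacent to some u ∈ R }, iterated n times from {u}
-- gives the set of vertices reachable from u inside H|_I.

step : ∀ {n} → Graph n → Subset n → Subset n → Subset n
step {n} H I R = tabulate λ w → mem w R ∨ (mem w I ∧ any (λ u → mem u R ∧ H u w) (allFin n))

iter : ∀ {A : Set} → ℕ → (A → A) → A → A
iter zero f a = a
iter (suc k) f a = f (iter k f a)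

reachIn : ∀ {n} → Graph n → Subset n → Fin n → Subset n
reachIn {n} H I u = iter n (step H I) (singleton u)

connectedᵇ : ∀ {n} → Graph n → Subset n → Bool
connectedᵇ {n} H I = all (λ u → not (mem u I) ∨ (I ⊆ᵇ reachIn H I u)) (allFin n)

inB : ∀ {n} → Graph n → Subset n → Bool
inB H I = nonemptyᵇ I ∧ connectedᵇ H I

isMax : ∀ {n} → Graph n → Subset n → Bool
isMax {n} H I = inB H I ∧ not (any (λ J → inB H J ∧ (I ⊂ᵇ J)) (allSubsets n))

numMax : ∀ {n} → Graph n → ℕ
numMax {n} H = countᵇ (isMax H) (allSubsets n)

pairwiseOK : ∀ {n} → List (Subset n) → Bool
pairwiseOK N = all (λ I → all (λ J → (I ⊆ᵇ J) ∨ (J ⊆ᵇ I) ∨ disjointᵇ I J) N) N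

pairwiseDisjoint : ∀ {n} → List (Subset n) → Bool
pairwiseDisjoint [] = true
pairwiseDisjoint (I ∷ S) = all (disjointᵇ I) S ∧ pairwiseDisjoint S

unionOK : ∀ {n} → Graph n → List (Subset n) → Bool
unionOK H N = all (λ S → not ((2 ≤ᵇ length S) ∧ pairwiseDisjoint S ∧ inB H (unionAll S))) (sublists N)

isNested : ∀ {n} → Graph n → List (Subset n) → Bool
isNested H N = all (λ I → inB H I ∧ not (isMax H I)) N ∧ pairwiseOK N ∧ unionOK H N

-- extended nested collection {I_1..I_m} ∪ {x_i | i ∈ X}
isExtNested : ∀ {n} → Graph n → List (Subset n) → Subset n → Bool
isExtNested H N X = all (inB H) N ∧ pairwiseOK N ∧ unionOK H N ∧ all (disjointᵇ X) N

subsetSize : ∀ {n} → Subset n → ℕ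
subsetSize {n} X = countᵇ (λ i → mem i X) (allFin n)

dimNesto : ∀ {n} → Graph n → ℕ
dimNesto {n} H = n ∸ numMax H

-- f_i(P(B_H)) = # nested collections of cardinality d - i  (0 for i > d)
fNesto : ∀ {n} → Graph n → ℕ → ℕ
fNesto {n} H i = countᵇ (λ N → isNested H N ∧ ((length N + i) ≡ᵇ dimNesto H))
                        (sublists (allSubsets n))

dimExt : ∀ {n} → Graph n → ℕ
dimExt {n} H = n

fExt : ∀ {n} → Graph n → ℕ → ℕ
fExt {n} H i = length (filterᵇ (λ p → isExtNested H (proj₁ p) (proj₂ p)
                                   ∧ ((length (proj₁ p) + subsetSize (proj₂ p) + i) ≡ᵇ n))
                        (concatMap (λ N → map (λ X → (N , X)) (allSubsets n))
                                   (sublists (allSubsets n))))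

-- h-polynomial: f(t) = h(t+1), i.e. h(t) = f(t-1), so
-- h_i = Σ_{j=i}^{d} (-1)^{j-i} C(j,i) f_j   (coefficient of t^i)

sumℤ : List ℤ → ℤ
sumℤ = foldr ℤ._+_ (+ 0)

signed : ℕ → ℤ → ℤ
signed zero z = z
signed (suc k) z = - signed k z

hCoeff : ℕ → (ℕ → ℕ) → ℕ → ℤ
hCoeff d f i = sumℤ (map (λ j → if i ≤ᵇ j then signed (j ∸ i) (+ ((j C i) Data.Nat.* f j)) else + 0)
                         (upTo (suc d)))

hNesto : ∀ {n} → Graph n → ℕ → ℤ
hNesto H = hCoeff (dimNesto H) (fNesto H)

hExt : ∀ {n} → Graph n → ℕ → ℤ
hExt H = hCoeff (dimExt H) (fExt H)

{-# OPTIONS --safe #-}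
module Submission where

-- For a set U of vertices of a graph let c(U) be its number of components and R_U(t) the
-- f-polynomial, by cardinality, of the nested collections inside U without the components of U.
-- Adding or removing components of U keeps a collection inside U nested, and a nested
-- collection has union U iff it lies in U and contains all of them; hence
--   (*)  Σ_{U' ⊆ U} t^c(U') R_U' = (1+t)^c(U) R_U,
-- which determines R from c and R_∅ = 1, and the extended f-polynomial is
-- Σ_M (1+t)^|Mᶜ| t^c(M) R_M.  In a forest, with E(U) the edges inside U and V(M) the ends of
-- the edges in M, c(U) = |U| - |E(U)| and the line graph has c(M) = |V(M)| - |M|.  For
--   D_U = Σ_{M ⊆ E(U)} (1+t)^|E(U)∖M| t^c(M) R_M   (R taken in the line graph)
-- expand (1+t)^|E(U')∖W| as Σ_{W ⊆ M ⊆ E(U')} t^|E(U')∖M|; as c(U') + |E(U')∖M| =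
-- c(M) + |U'∖V(M)|, summing over U' and using (*) in the line graph gives (*) for D.
-- Hence R = D, and at the full vertex set this compares the two f-polynomials.

open import Defs
open import Data.Bool using (Bool; true; false; _∧_; _∨_; not; if_then_else_)
import Data.Bool as Bool
open import Data.Bool.ListAction using (all; any)
open import Data.Bool.Properties using (T-≡; ∨-zeroʳ; ¬-not)
open import Data.Empty using (⊥; ⊥-elim)
open import Data.Fin using (Fin; zero; suc; _≟_; toℕ; inject₁; fromℕ; fromℕ<)
open import Data.Fin.Properties using (any?; toℕ<n; toℕ-fromℕ; toℕ-fromℕ<; toℕ-inject₁; toℕ-injective; injective⇒≤)
open import Data.Fin.Subset using (Subset; ∣_∣)
open import Data.Fin.Subset.Properties using (∣p∣≤n; ∣⊤∣≡n)
import Data.Integer as ℤ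
open import Data.List using (List; []; _∷_; _++_; map; length; filterᵇ; allFin; concatMap; upTo)
import Data.List as List
open import Data.List.Membership.DecPropositional using () renaming (_∈?_ to ∈?-via)
open import Data.List.Membership.Propositional using (find) renaming (_∈_ to _∈ˡ_)
open import Data.List.Membership.Propositional.Properties using (∈-++⁺ˡ; ∈-++⁺ʳ; ∈-++⁻; ∈-map⁺; ∈-map⁻; ∈-allFin; ∈-filter⁺; ∈-filter⁻; ∈-∃++; ∈-concatMap⁺; ∈-concatMap⁻; ∈-lookup)
open import Data.List.Properties using (length-++; length-map; map-cong)
open import Data.List.Relation.Unary.All as All using ([]; _∷_)
open import Data.List.Relation.Unary.AllPairs using ([]; _∷_)
open import Data.List.Relation.Unary.Any as Any using (here; there)
open import Data.List.Relation.Unary.Any.Properties using (lookup-index)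
open import Data.List.Relation.Unary.Unique.Propositional using (Unique)
import Data.List.Relation.Unary.Unique.Propositional.Properties as Uniq
open import Data.Nat using (ℕ; zero; suc; _+_; _*_; _∸_; _^_; _≤_; _<_; z≤n; s≤s; _≡ᵇ_; _≤ᵇ_; _<ᵇ_; NonZero)
import Data.Nat.Combinatorics as Comb
open import Data.Nat.DivMod using (_%_; [m+kn]%n≡m%n; m<n⇒m%n≡m)
open import Data.Nat.Induction using (<-rec; <-wellFounded)
open import Data.Nat.Properties hiding (_≟_)
open import Data.Nat.Solver using (module +-*-Solver)
open import Data.Product using (∃; _×_; _,_; proj₁; proj₂)
open import Data.Sum using (_⊎_; inj₁; inj₂; swap)
open import Data.Vec using ([]; _∷_; replicate; zipWith; tabulate)
import Data.Vec as Vec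
open import Data.Vec.Properties using (lookup∘tabulate; lookup-zipWith; lookup-replicate; lookup-map; ∷-injective; tabulate∘lookup; tabulate-cong; ≡-dec)
open import Function using (_∘_; id; Equivalence)
open import Function.Definitions using (Injective)
open import Induction.WellFounded using (Acc; acc)
open import Relation.Binary.Definitions using (tri<; tri≈; tri>)
open import Relation.Binary.PropositionalEquality
open import Relation.Nullary using (¬_; Dec; yes; no; contradiction)
open import Relation.Nullary.Decidable using (_×-dec_; ¬?; decidable-stable)

open +-*-Solver using (solve; _:+_; _:*_; _:=_; con)

-- No polynomial is formed. Each generating function is a natural number depending on an arbitrary
-- `t : ℕ`, and agreement for every `t` gives back the coefficients, since a large `t` turns them
-- into base-`t` digits. Identities are written additively, with differences of cardinalities
-- replaced by `codim`, so that truncated subtraction stays out of the exponents. No bijection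
-- between the two kinds of collections is constructed; two solutions of one recursion are compared.
-- In (*) the term U' = U has coefficient t^c(U) on the left and (1+t)^c(U) on the right. The latter
-- is larger as soon as c(U) > 0, so R_U is determined by the proper subsets of U, and c(U) = 0
-- happens only for U = ∅. Acyclicity supplies the two counts of components. Removing leaves one by
-- one orients every edge towards a parent, and both counts come from labelling a vertex, or an
-- edge, by the root above it. The count at the full vertex set also makes the two dimensions equal,
-- so that equal f-numbers give equal h-numbers.

private
  variable
    A C : Set
    n : ℕ
    x y : A
    xs ys : List A

-- Booleans as propositions

∧-true : ∀ {a b} → a ≡ true → b ≡ true → a ∧ b ≡ true
∧-true refl refl = refl

∧-true⁻ : ∀ {a b} → a ∧ b ≡ true → a ≡ true × b ≡ true
∧-true⁻ {true} {true} _ = refl , refl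

∨-true⁻ : ∀ {a b} → a ∨ b ≡ true → a ≡ true ⊎ b ≡ true
∨-true⁻ {true} _ = inj₁ refl
∨-true⁻ {false} p = inj₂ p

∨-trueˡ : ∀ {a b} → a ≡ true → a ∨ b ≡ true
∨-trueˡ refl = refl

∨-trueʳ : ∀ {a b} → b ≡ true → a ∨ b ≡ true
∨-trueʳ {a} refl = ∨-zeroʳ a

not-true⁻ : ∀ {a} → not a ≡ true → a ≢ true
not-true⁻ {true} ()

not-true : ∀ {a} → a ≢ true → not a ≡ true
not-true {true} p = contradiction refl p
not-true {false} _ = refl

implies-true : ∀ {a b} → (a ≡ true → b ≡ true) → not a ∨ b ≡ true
implies-true {true} f = f refl
implies-true {false} _ = refl

implies-true⁻ : ∀ {a b} → not a ∨ b ≡ true → a ≡ true → b ≡ true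
implies-true⁻ p refl = p

true-ext : ∀ {a b} → (a ≡ true → b ≡ true) → (b ≡ true → a ≡ true) → a ≡ b
true-ext {true} f _ = sym (f refl)
true-ext {false} {true} _ g = g refl
true-ext {false} {false} _ _ = refl

true? : (b : Bool) → Dec (b ≡ true)
true? b = b Bool.≟ true

all-true : {p : A → Bool} → (∀ {x} → x ∈ˡ xs → p x ≡ true) → all p xs ≡ true
all-true {xs = []} f = refl
all-true {xs = x ∷ xs} f = ∧-true (f (here refl)) (all-true (f ∘ there))

all-true⁻ : {p : A → Bool} → all p xs ≡ true → x ∈ˡ xs → p x ≡ true
all-true⁻ e (here refl) = proj₁ (∧-true⁻ e)
all-true⁻ {xs = y ∷ xs} {p = p} e (there i) = all-true⁻ (proj₂ (∧-true⁻ {p y} e)) i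

any-true : {p : A → Bool} → x ∈ˡ xs → p x ≡ true → any p xs ≡ true
any-true (here refl) e = ∨-trueˡ e
any-true {xs = y ∷ xs} {p = p} (there i) e = ∨-trueʳ {p y} (any-true i e)

any-true⁻ : {p : A → Bool} → any p xs ≡ true → ∃ λ x → x ∈ˡ xs × p x ≡ true
any-true⁻ {xs = y ∷ xs} {p = p} e with ∨-true⁻ {p y} e
... | inj₁ e′ = y , here refl , e′
... | inj₂ e′ with any-true⁻ {xs = xs} e′
... | x , i , px = x , there i , px

∈-filterᵇ : (p : A → Bool) → x ∈ˡ xs → p x ≡ true → x ∈ˡ filterᵇ p xs
∈-filterᵇ p i e = ∈-filter⁺ _ i (Equivalence.from T-≡ e)

∈-filterᵇ⁻ : (p : A → Bool) (xs : List A) → x ∈ˡ filterᵇ p xs → x ∈ˡ xs × p x ≡ true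
∈-filterᵇ⁻ p xs i with ∈-filter⁻ _ {xs = xs} i
... | i′ , e = i′ , Equivalence.to T-≡ e

filterᵇ-unique : (p : A → Bool) → Unique xs → Unique (filterᵇ p xs)
filterᵇ-unique p = Uniq.filter⁺ _

∈-++-drop : ∀ (as : List A) {bs} → y ∈ˡ as ++ x ∷ bs → x ≢ y → y ∈ˡ as ++ bs
∈-++-drop [] (here refl) ne = contradiction refl ne
∈-++-drop [] (there i) ne = i
∈-++-drop (a ∷ as) (here e) ne = here e
∈-++-drop (a ∷ as) (there i) ne = there (∈-++-drop as i ne)

unique-length-≤ : Unique xs → (∀ {x} → x ∈ˡ xs → x ∈ˡ ys) → length xs ≤ length ys
unique-length-≤ [] _ = z≤n
unique-length-≤ {xs = x ∷ xs} {ys = ys} (x∉ ∷ u) sub with ∈-∃++ (sub (here refl))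
... | as , bs , refl = begin
  suc (length xs)           ≤⟨ s≤s (unique-length-≤ u λ i → ∈-++-drop as (sub (there i)) (All.lookup x∉ i)) ⟩
  suc (length (as ++ bs))   ≡⟨ cong suc (length-++ as) ⟩
  suc (length as + length bs) ≡⟨ +-suc (length as) (length bs) ⟨
  length as + suc (length bs) ≡⟨ length-++ as ⟨
  length (as ++ x ∷ bs)     ∎
  where open ≤-Reasoning

unique-length-≡ : Unique xs → Unique ys → (∀ {x} → x ∈ˡ xs → x ∈ˡ ys) → (∀ {x} → x ∈ˡ ys → x ∈ˡ xs) →
                  length xs ≡ length ys
unique-length-≡ u v f g = ≤-antisym (unique-length-≤ u f) (unique-length-≤ v g)

-- Sums over lists

∑ : List A → (A → ℕ) → ℕ
∑ [] f = 0
∑ (x ∷ xs) f = f x + ∑ xs f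

⟦_⟧ : Bool → ℕ
⟦ true ⟧ = 1
⟦ false ⟧ = 0

⟦∧⟧ : ∀ a b → ⟦ a ∧ b ⟧ ≡ ⟦ a ⟧ * ⟦ b ⟧
⟦∧⟧ true b = sym (+-identityʳ _)
⟦∧⟧ false b = refl

⟦⟧-cong-* : ∀ b {k l} → (b ≡ true → k ≡ l) → ⟦ b ⟧ * k ≡ ⟦ b ⟧ * l
⟦⟧-cong-* true e = cong (1 *_) (e refl)
⟦⟧-cong-* false e = refl

∑-cong : {f g : A → ℕ} (xs : List A) → (∀ x → x ∈ˡ xs → f x ≡ g x) → ∑ xs f ≡ ∑ xs g
∑-cong [] e = refl
∑-cong (x ∷ xs) e = cong₂ _+_ (e x (here refl)) (∑-cong xs λ y i → e y (there i))

∑-ext : {f g : A → ℕ} (xs : List A) → (∀ x → f x ≡ g x) → ∑ xs f ≡ ∑ xs g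
∑-ext xs e = ∑-cong xs λ x _ → e x

∑-++ : (f : A → ℕ) (xs ys : List A) → ∑ (xs ++ ys) f ≡ ∑ xs f + ∑ ys f
∑-++ f [] ys = refl
∑-++ f (x ∷ xs) ys = trans (cong (f x +_) (∑-++ f xs ys)) (sym (+-assoc (f x) _ _))

∑-map : (f : C → ℕ) (g : A → C) (xs : List A) → ∑ (map g xs) f ≡ ∑ xs (f ∘ g)
∑-map f g [] = refl
∑-map f g (x ∷ xs) = cong (f (g x) +_) (∑-map f g xs)

∑-concatMap : (f : C → ℕ) (g : A → List C) (xs : List A) → ∑ (concatMap g xs) f ≡ ∑ xs (λ x → ∑ (g x) f)
∑-concatMap f g [] = refl
∑-concatMap f g (x ∷ xs) = trans (∑-++ f (g x) _) (cong (∑ (g x) f +_) (∑-concatMap f g xs))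

∑-*ˡ : (k : ℕ) (f : A → ℕ) (xs : List A) → ∑ xs (λ x → k * f x) ≡ k * ∑ xs f
∑-*ˡ k f [] = sym (*-zeroʳ k)
∑-*ˡ k f (x ∷ xs) = trans (cong (k * f x +_) (∑-*ˡ k f xs)) (sym (*-distribˡ-+ k (f x) _))

∑-*ʳ : (k : ℕ) (f : A → ℕ) (xs : List A) → ∑ xs (λ x → f x * k) ≡ ∑ xs f * k
∑-*ʳ k f xs = trans (∑-ext xs λ x → *-comm (f x) k) (trans (∑-*ˡ k f xs) (*-comm k _))

∑-zero : (xs : List A) → ∑ xs (λ _ → 0) ≡ 0
∑-zero [] = refl
∑-zero (x ∷ xs) = ∑-zero xs

∑-+ : (f g : A → ℕ) (xs : List A) → ∑ xs (λ x → f x + g x) ≡ ∑ xs f + ∑ xs g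
∑-+ f g [] = refl
∑-+ f g (x ∷ xs) = trans (cong (f x + g x +_) (∑-+ f g xs))
  (solve 4 (λ a b c d → (a :+ b) :+ (c :+ d) := (a :+ c) :+ (b :+ d)) refl (f x) (g x) _ _)

∑-swap : (f : A → C → ℕ) (xs : List A) (ys : List C) →
         ∑ xs (λ x → ∑ ys (f x)) ≡ ∑ ys (λ y → ∑ xs (λ x → f x y))
∑-swap f [] ys = sym (∑-zero ys)
∑-swap f (x ∷ xs) ys = trans (cong (∑ ys (f x) +_) (∑-swap f xs ys)) (sym (∑-+ (f x) _ ys))

∑-filterᵇ : (p : A → Bool) (f : A → ℕ) (xs : List A) → ∑ (filterᵇ p xs) f ≡ ∑ xs (λ x → ⟦ p x ⟧ * f x)
∑-filterᵇ p f [] = refl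
∑-filterᵇ p f (x ∷ xs) with p x
... | true = cong₂ _+_ (sym (+-identityʳ (f x))) (∑-filterᵇ p f xs)
... | false = ∑-filterᵇ p f xs

-- Subfamilies

∑-sublists-∷ : (f : List A → ℕ) (x : A) (xs : List A) →
               ∑ (sublists (x ∷ xs)) f ≡ ∑ (sublists xs) f + ∑ (sublists xs) (f ∘ (x ∷_))
∑-sublists-∷ f x xs = trans (∑-++ f (sublists xs) _) (cong (∑ (sublists xs) f +_) (∑-map f (x ∷_) (sublists xs)))

∈-sublists-∷⁻ : ∀ (y : A) ys → xs ∈ˡ sublists (y ∷ ys) → xs ∈ˡ sublists ys ⊎ (∃ λ zs → zs ∈ˡ sublists ys × xs ≡ y ∷ zs)
∈-sublists-∷⁻ y ys i with ∈-++⁻ (sublists ys) i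
... | inj₁ j = inj₁ j
... | inj₂ j = inj₂ (∈-map⁻ _ j)

sublists-⊆ : xs ∈ˡ sublists ys → x ∈ˡ xs → x ∈ˡ ys
sublists-⊆ {ys = []} (here refl) ()
sublists-⊆ {ys = y ∷ ys} i j with ∈-sublists-∷⁻ y ys i
... | inj₁ i′ = there (sublists-⊆ i′ j)
... | inj₂ (zs , i′ , refl) with j
...   | here e = here e
...   | there j′ = there (sublists-⊆ i′ j′)

sublists-unique : Unique ys → xs ∈ˡ sublists ys → Unique xs
sublists-unique {ys = []} u (here refl) = []
sublists-unique {ys = y ∷ ys} (y∉ ∷ u) i with ∈-sublists-∷⁻ y ys i
... | inj₁ i′ = sublists-unique u i′
... | inj₂ (zs , i′ , refl) = All.tabulate (λ j → All.lookup y∉ (sublists-⊆ i′ j)) ∷ sublists-unique u i′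

filterᵇ∈sublists : (p : A → Bool) (xs : List A) → filterᵇ p xs ∈ˡ sublists xs
filterᵇ∈sublists p [] = here refl
filterᵇ∈sublists p (x ∷ xs) with p x
... | true = ∈-++⁺ʳ (sublists xs) (∈-map⁺ _ (filterᵇ∈sublists p xs))
... | false = ∈-++⁺ˡ (filterᵇ∈sublists p xs)

countᵇ-sublist-≤ : (q : A → Bool) (ys : List A) → xs ∈ˡ sublists ys → countᵇ q xs ≤ countᵇ q ys
countᵇ-sublist-≤ q [] (here refl) = z≤n
countᵇ-sublist-≤ q (y ∷ ys) i with ∈-sublists-∷⁻ y ys i
... | inj₁ i′ with q y
...   | true = m≤n⇒m≤1+n (countᵇ-sublist-≤ q ys i′)
...   | false = countᵇ-sublist-≤ q ys i′
countᵇ-sublist-≤ q (y ∷ ys) i | inj₂ (zs , i′ , refl) with q y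
...   | true = s≤s (countᵇ-sublist-≤ q ys i′)
...   | false = countᵇ-sublist-≤ q ys i′

-- A sublist that skips a `q`-entry can never make up the deficit, by `countᵇ-sublist-≤`. Equality
-- of counts thus encodes that all `q`-entries are present, in a form that the recursion of
-- `∑-sublists-full` can follow.
countᵇ-full : (q : A → Bool) → xs ∈ˡ sublists ys → countᵇ q xs ≡ countᵇ q ys →
              x ∈ˡ ys → q x ≡ true → x ∈ˡ xs
countᵇ-full {ys = y ∷ ys} q i e j qx with ∈-sublists-∷⁻ y ys i
countᵇ-full {ys = y ∷ ys} q i e j qx | inj₁ i′ with q y in eq
...   | true = contradiction (≤-trans (≤-reflexive (sym e)) (countᵇ-sublist-≤ q ys i′)) 1+n≰n
...   | false with j
...     | here refl = contradiction (trans (sym eq) qx) λ ()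
...     | there j′ = countᵇ-full q i′ e j′ qx
countᵇ-full {ys = y ∷ ys} q i e (here refl) qx | inj₂ (zs , i′ , refl) = here refl
countᵇ-full {ys = y ∷ ys} q i e (there j) qx | inj₂ (zs , i′ , refl) with q y
...   | true = there (countᵇ-full q i′ (suc-injective e) j qx)
...   | false = there (countᵇ-full q i′ e j qx)

full-countᵇ : (q : A → Bool) → Unique ys → xs ∈ˡ sublists ys → (∀ {x} → x ∈ˡ ys → q x ≡ true → x ∈ˡ xs) →
              countᵇ q xs ≡ countᵇ q ys
full-countᵇ {ys = ys} {xs = xs} q uy i f = unique-length-≡ (filterᵇ-unique q (sublists-unique uy i)) (filterᵇ-unique q uy)
  (λ j → let (a , b) = ∈-filterᵇ⁻ q xs j in ∈-filterᵇ q (sublists-⊆ {ys = ys} i a) b)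
  (λ j → let (a , b) = ∈-filterᵇ⁻ q ys j in ∈-filterᵇ q (f a b) b)

≡ᵇ-false : ∀ {k l} → k ≤ l → (k ≡ᵇ suc l) ≡ false
≡ᵇ-false z≤n = refl
≡ᵇ-false (s≤s p) = ≡ᵇ-false p

-- Sums over sublists with marked entries

module _ (t : ℕ) (q : A → Bool) where

  private
    q′ : A → Bool
    q′ = not ∘ q

  -- The weight `g` does not see the marked entries, so each of them is left out or taken
  -- independently and contributes a factor `1 + t`. The induction needs arbitrary `g`: an unmarked
  -- head that is taken is absorbed into the weight together with its factor `t`.
  ∑-sublists-free : (g : List A → ℕ) (xs : List A) →
    ∑ (sublists xs) (λ N → g (filterᵇ q′ N) * t ^ length N)
    ≡ (1 + t) ^ countᵇ q xs * ∑ (sublists (filterᵇ q′ xs)) (λ N → g N * t ^ length N)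
  ∑-sublists-free g [] = sym (+-identityʳ _)
  ∑-sublists-free g (x ∷ xs) with ∑-sublists-∷ (λ N → g (filterᵇ q′ N) * t ^ length N) x xs
  ... | e with q x
  ...   | true = trans e (trans (cong₂ _+_ (∑-sublists-free g xs)
            (trans (∑-ext (sublists xs) λ N → solve 3 (λ a t b → a :* (t :* b) := t :* (a :* b)) refl (g (filterᵇ q′ N)) t _)
              (trans (∑-*ˡ t _ (sublists xs)) (cong (t *_) (∑-sublists-free g xs)))))
          (solve 3 (λ a b t → a :* b :+ t :* (a :* b) := (con 1 :+ t) :* a :* b) refl ((1 + t) ^ countᵇ q xs) _ t))
  ...   | false = trans e (trans (cong₂ _+_ (∑-sublists-free g xs)
            (trans (∑-ext (sublists xs) λ N → solve 3 (λ a t b → a :* (t :* b) := t :* a :* b) refl (g (x ∷ filterᵇ q′ N)) t _)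
              (∑-sublists-free (λ N → t * g (x ∷ N)) xs)))
          (trans (sym (*-distribˡ-+ ((1 + t) ^ countᵇ q xs) _ _))
            (cong ((1 + t) ^ countᵇ q xs *_)
              (trans (cong (∑ (sublists (filterᵇ q′ xs)) (λ N → g N * t ^ length N) +_)
                (∑-ext (sublists (filterᵇ q′ xs)) λ N → solve 3 (λ a t b → t :* a :* b := a :* (t :* b)) refl (g (x ∷ N)) t _))
              (sym (∑-sublists-∷ _ x (filterᵇ q′ xs)))))))

  -- The counterpart of `∑-sublists-free` with every marked entry forced to be present: each one now
  -- contributes `t` in place of `1 + t`.
  ∑-sublists-full : (g : List A → ℕ) (xs : List A) →
    ∑ (sublists xs) (λ N → ⟦ countᵇ q N ≡ᵇ countᵇ q xs ⟧ * (g (filterᵇ q′ N) * t ^ length N))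
    ≡ t ^ countᵇ q xs * ∑ (sublists (filterᵇ q′ xs)) (λ N → g N * t ^ length N)
  ∑-sublists-full g [] = refl
  ∑-sublists-full g (x ∷ xs)
    with ∑-sublists-∷ (λ N → ⟦ countᵇ q N ≡ᵇ countᵇ q (x ∷ xs) ⟧ * (g (filterᵇ q′ N) * t ^ length N)) x xs
  ... | e with q x
  ...   | true = trans e (trans (cong₂ _+_
            (trans (∑-cong (sublists xs) λ N i → cong (λ b → ⟦ b ⟧ * (g (filterᵇ q′ N) * t ^ length N)) (≡ᵇ-false (countᵇ-sublist-≤ q xs i)))
                   (∑-zero (sublists xs)))
            (trans (∑-ext (sublists xs) λ N → solve 4 (λ c a t b → c :* (a :* (t :* b)) := t :* (c :* (a :* b))) refl
                       ⟦ countᵇ q N ≡ᵇ countᵇ q xs ⟧ (g (filterᵇ q′ N)) t (t ^ length N))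
              (trans (∑-*ˡ t _ (sublists xs)) (cong (t *_) (∑-sublists-full g xs)))))
          (sym (*-assoc t (t ^ countᵇ q xs) _)))
  ...   | false = trans e (trans (cong₂ _+_ (∑-sublists-full g xs)
            (trans (∑-ext (sublists xs) λ N → solve 4 (λ c a t b → c :* (a :* (t :* b)) := c :* (t :* a :* b)) refl
                      ⟦ countᵇ q N ≡ᵇ countᵇ q xs ⟧ (g (x ∷ filterᵇ q′ N)) t (t ^ length N))
              (∑-sublists-full (λ N → t * g (x ∷ N)) xs)))
          (trans (sym (*-distribˡ-+ (t ^ countᵇ q xs) _ _))
            (cong (t ^ countᵇ q xs *_)
              (trans (cong (∑ (sublists (filterᵇ q′ xs)) (λ N → g N * t ^ length N) +_)
                (∑-ext (sublists (filterᵇ q′ xs)) λ N → solve 3 (λ a t b → t :* a :* b := a :* (t :* b)) refl (g (x ∷ N)) t (t ^ length N)))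
              (sym (∑-sublists-∷ _ x (filterᵇ q′ xs)))))))

∑-sublists-all : (p : A → Bool) (f : List A → ℕ) (xs : List A) →
                 ∑ (sublists xs) (λ N → ⟦ all p N ⟧ * f N) ≡ ∑ (sublists (filterᵇ p xs)) f
∑-sublists-all p f [] = cong (_+ 0) (+-identityʳ (f []))
∑-sublists-all p f (x ∷ xs) with ∑-sublists-∷ (λ N → ⟦ all p N ⟧ * f N) x xs
... | e with p x
...   | true = trans e (trans (cong₂ _+_ (∑-sublists-all p f xs) (∑-sublists-all p (f ∘ (x ∷_)) xs))
                (sym (∑-sublists-∷ f x (filterᵇ p xs))))
...   | false = trans e (trans (cong₂ _+_ (∑-sublists-all p f xs) (∑-zero (sublists xs))) (+-identityʳ _))

-- Subsets of a finite set

infix 4 _∈_ _⊆_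

_∈_ : Fin n → Subset n → Set
i ∈ I = mem i I ≡ true

_⊆_ : Subset n → Subset n → Set
I ⊆ J = ∀ i → i ∈ I → i ∈ J

∅ full : Subset n
∅ = replicate _ false
full = replicate _ true

∉∅ : ∀ (i : Fin n) → ¬ i ∈ ∅
∉∅ i e = contradiction (trans (sym (lookup-replicate i false)) e) λ ()

∈full : ∀ (i : Fin n) → i ∈ full
∈full i = lookup-replicate i true

mem-tabulate : (f : Fin n → Bool) (i : Fin n) → mem i (tabulate f) ≡ f i
mem-tabulate f i = lookup∘tabulate f i

∈-tabulate : (f : Fin n → Bool) (i : Fin n) → f i ≡ true → i ∈ tabulate f
∈-tabulate f i e = trans (mem-tabulate f i) e

∈-tabulate⁻ : (f : Fin n → Bool) (i : Fin n) → i ∈ tabulate f → f i ≡ true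
∈-tabulate⁻ f i e = trans (sym (mem-tabulate f i)) e

mem-ext : {I J : Subset n} → (∀ i → mem i I ≡ mem i J) → I ≡ J
mem-ext {I = I} {J} e = trans (sym (tabulate∘lookup I)) (trans (tabulate-cong e) (tabulate∘lookup J))

⊆-refl : (I : Subset n) → I ⊆ I
⊆-refl I i e = e

⊆-antisym : (I J : Subset n) → I ⊆ J → J ⊆ I → I ≡ J
⊆-antisym I J f g = mem-ext λ i → true-ext (f i) (g i)

⊆ᵇ-true : (I J : Subset n) → I ⊆ J → (I ⊆ᵇ J) ≡ true
⊆ᵇ-true I J f = all-true {xs = allFin _} {p = λ i → not (mem i I) ∨ mem i J} λ {i} _ → implies-true (f i)

⊆ᵇ-true⁻ : (I J : Subset n) → (I ⊆ᵇ J) ≡ true → I ⊆ J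
⊆ᵇ-true⁻ I J e i = implies-true⁻ (all-true⁻ {p = λ i → not (mem i I) ∨ mem i J} e (∈-allFin i))

_⊆?_ : (I J : Subset n) → Dec (I ⊆ J)
I ⊆? J with true? (I ⊆ᵇ J)
... | yes e = yes (⊆ᵇ-true⁻ I J e)
... | no ne = no λ f → ne (⊆ᵇ-true I J f)

infix 4 _⊊_

_⊊_ : Subset n → Subset n → Set
I ⊊ J = I ⊆ J × ¬ J ⊆ I

⊂ᵇ-true : (I J : Subset n) → I ⊊ J → (I ⊂ᵇ J) ≡ true
⊂ᵇ-true I J (a , b) = ∧-true (⊆ᵇ-true I J a) (not-true λ e → b (⊆ᵇ-true⁻ J I e))

⊂ᵇ-true⁻ : (I J : Subset n) → (I ⊂ᵇ J) ≡ true → I ⊊ J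
⊂ᵇ-true⁻ I J e with ∧-true⁻ {I ⊆ᵇ J} e
... | a , b = ⊆ᵇ-true⁻ I J a , λ f → not-true⁻ b (⊆ᵇ-true J I f)

Disjoint : Subset n → Subset n → Set
Disjoint I J = ∀ i → i ∈ I → i ∈ J → ⊥

disjointᵇ-true : (I J : Subset n) → Disjoint I J → disjointᵇ I J ≡ true
disjointᵇ-true I J f = all-true {xs = allFin _} {p = λ i → not (mem i I ∧ mem i J)}
  λ {i} _ → not-true λ e → let (a , b) = ∧-true⁻ {mem i I} e in f i a b

disjointᵇ-true⁻ : (I J : Subset n) → disjointᵇ I J ≡ true → Disjoint I J
disjointᵇ-true⁻ I J e i a b =
  not-true⁻ (all-true⁻ {p = λ i → not (mem i I ∧ mem i J)} e (∈-allFin i)) (∧-true a b)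

⊈⇒∃ : (I J : Subset n) → ¬ I ⊆ J → ∃ λ i → i ∈ I × ¬ i ∈ J
⊈⇒∃ I J ne with true? (any (λ i → mem i I ∧ not (mem i J)) (allFin _))
... | yes e with any-true⁻ {xs = allFin _} e
...   | i , _ , e′ = i , proj₁ (∧-true⁻ e′) , not-true⁻ (proj₂ (∧-true⁻ {mem i I} e′))
⊈⇒∃ I J ne | no none = contradiction sub ne
  where
  sub : I ⊆ J
  sub i e with true? (mem i J)
  ... | yes e′ = e′
  ... | no e′ = contradiction (any-true {p = λ i → mem i I ∧ not (mem i J)} (∈-allFin i) (∧-true e (not-true e′))) none

∈-unionAll : {i : Fin n} {I : Subset n} {N : List (Subset n)} → I ∈ˡ N → i ∈ I → i ∈ unionAll N
∈-unionAll {i = i} {I} {N = J ∷ N} (here refl) e = trans (lookup-zipWith _∨_ i J (unionAll N)) (∨-trueˡ e)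
∈-unionAll {i = i} {I} {N = J ∷ N} (there j) e =
  trans (lookup-zipWith _∨_ i J (unionAll N)) (∨-trueʳ {mem i J} (∈-unionAll j e))

∈-unionAll⁻ : {i : Fin n} (N : List (Subset n)) → i ∈ unionAll N → ∃ λ I → I ∈ˡ N × i ∈ I
∈-unionAll⁻ {i = i} [] e = contradiction e (∉∅ i)
∈-unionAll⁻ {i = i} (J ∷ N) e with ∨-true⁻ {mem i J} (trans (sym (lookup-zipWith _∨_ i J (unionAll N))) e)
... | inj₁ e′ = J , here refl , e′
... | inj₂ e′ with ∈-unionAll⁻ N e′
...   | I , j , e″ = I , there j , e″

∈-allSubsets : (I : Subset n) → I ∈ˡ allSubsets n
∈-allSubsets [] = here refl
∈-allSubsets (false ∷ I) = ∈-++⁺ˡ (∈-map⁺ _ (∈-allSubsets I))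
∈-allSubsets {suc n} (true ∷ I) = ∈-++⁺ʳ (map (false ∷_) (allSubsets n)) (∈-map⁺ _ (∈-allSubsets I))

allSubsets-unique : ∀ n → Unique (allSubsets n)
allSubsets-unique zero = [] ∷ []
allSubsets-unique (suc n) = Uniq.++⁺
  (Uniq.map⁺ (λ e → proj₂ (∷-injective e)) (allSubsets-unique n))
  (Uniq.map⁺ (λ e → proj₂ (∷-injective e)) (allSubsets-unique n))
  λ (a , b) → clash (∈-map⁻ _ a) (∈-map⁻ _ b)
  where
  clash : ∀ {I} → (∃ λ J → J ∈ˡ allSubsets n × I ≡ false ∷ J) → (∃ λ J → J ∈ˡ allSubsets n × I ≡ true ∷ J) → ⊥
  clash (_ , _ , refl) (_ , _ , ())

length-filterᵇ-tabulate : (p : A → Bool) (f : Fin n → A) →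
                          length (filterᵇ p (List.tabulate f)) ≡ ∣ tabulate (p ∘ f) ∣
length-filterᵇ-tabulate {n = zero} p f = refl
length-filterᵇ-tabulate {n = suc n} p f with p (f zero)
... | true = cong suc (length-filterᵇ-tabulate p (f ∘ suc))
... | false = length-filterᵇ-tabulate p (f ∘ suc)

subsetSize≡∣∣ : (I : Subset n) → subsetSize I ≡ ∣ I ∣
subsetSize≡∣∣ I = trans (length-filterᵇ-tabulate (λ i → mem i I) id) (cong ∣_∣ (tabulate∘lookup I))

-- The number of elements of `J` outside `I`. The recursion runs coordinate by coordinate, as does
-- the induction in `interval-binomial`.
codim : Subset n → Subset n → ℕ
codim [] [] = 0
codim (y ∷ J) (x ∷ I) = ⟦ y ∧ not x ⟧ + codim J I

codim+∣∣ : (I J : Subset n) → I ⊆ J → codim J I + ∣ I ∣ ≡ ∣ J ∣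
codim+∣∣ [] [] f = refl
codim+∣∣ (false ∷ I) (false ∷ J) f = codim+∣∣ I J λ i → f (suc i)
codim+∣∣ (false ∷ I) (true ∷ J) f = cong suc (codim+∣∣ I J λ i → f (suc i))
codim+∣∣ (true ∷ I) (false ∷ J) f with () ← f zero refl
codim+∣∣ (true ∷ I) (true ∷ J) f = trans (+-suc _ _) (cong suc (codim+∣∣ I J λ i → f (suc i)))

codim≡0 : (I J : Subset n) → codim J I ≡ 0 → J ⊆ I
codim≡0 (true ∷ I) (y ∷ J) e zero p = refl
codim≡0 (false ∷ I) (true ∷ J) () zero p
codim≡0 (x ∷ I) (y ∷ J) e (suc i) p = codim≡0 I J (m+n≡0⇒n≡0 ⟦ y ∧ not x ⟧ e) i p

⊊⇒∣∣< : (I J : Subset n) → I ⊊ J → ∣ I ∣ < ∣ J ∣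
⊊⇒∣∣< I J (f , g) with codim J I in eq
... | zero = contradiction (codim≡0 I J eq) g
... | suc k = ≤-trans (s≤s (m≤n+m _ k)) (≤-reflexive (trans (cong (_+ ∣ I ∣) (sym eq)) (codim+∣∣ I J f)))

-- Sums over intervals of subsets

∑-allSubsets : (f : Subset (suc n) → ℕ) →
               ∑ (allSubsets (suc n)) f ≡ ∑ (allSubsets n) (f ∘ (false ∷_)) + ∑ (allSubsets n) (f ∘ (true ∷_))
∑-allSubsets {n} f = trans (∑-++ f (map (false ∷_) (allSubsets n)) _)
  (cong₂ _+_ (∑-map f _ (allSubsets n)) (∑-map f _ (allSubsets n)))

⊆ᵇ-∷ : ∀ x y (I J : Subset n) → ((x ∷ I) ⊆ᵇ (y ∷ J)) ≡ (not x ∨ y) ∧ (I ⊆ᵇ J)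
⊆ᵇ-∷ x y I J = true-ext
  (λ e → let f = ⊆ᵇ-true⁻ (x ∷ I) (y ∷ J) e in ∧-true (implies-true (f zero)) (⊆ᵇ-true I J λ i → f (suc i)))
  (λ e → let (a , b) = ∧-true⁻ e in ⊆ᵇ-true (x ∷ I) (y ∷ J) λ
    { zero → implies-true⁻ a ; (suc i) → ⊆ᵇ-true⁻ I J (proj₂ (∧-true⁻ {not x ∨ y} e)) i })

-- The sum is a product over coordinates: an element of `Q` outside `W` gives `s + t`, an element of
-- `W` outside `Q` gives 0, and any other gives 1. With `(1 , t)` it expands a power of `1 + t`;
-- with `(t , 1)` it sums such an expansion up again.
interval-binomial : ∀ s t (W Q : Subset n) →
  ∑ (allSubsets n) (λ M → ⟦ W ⊆ᵇ M ⟧ * (⟦ M ⊆ᵇ Q ⟧ * (s ^ codim M W * t ^ codim Q M)))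
  ≡ ⟦ W ⊆ᵇ Q ⟧ * (s + t) ^ codim Q W
interval-binomial s t [] [] = refl
interval-binomial {suc n} s t (w ∷ W) (q ∷ Q) = trans (∑-allSubsets {n} _)
  (trans (cong₂ _+_ (half false) (half true))
    (trans (sums w q) (cong (λ b → ⟦ b ⟧ * (s + t) ^ (⟦ q ∧ not w ⟧ + codim Q W)) (sym (⊆ᵇ-∷ w q W Q)))))
  where
  S = ⟦ W ⊆ᵇ Q ⟧ * (s + t) ^ codim Q W
  coef : Bool → ℕ
  coef m = ⟦ not w ∨ m ⟧ * (⟦ not m ∨ q ⟧ * (s ^ ⟦ m ∧ not w ⟧ * t ^ ⟦ q ∧ not m ⟧))
  half : ∀ m → ∑ (allSubsets n) (λ M → ⟦ (w ∷ W) ⊆ᵇ (m ∷ M) ⟧ * (⟦ (m ∷ M) ⊆ᵇ (q ∷ Q) ⟧ *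
                 (s ^ (⟦ m ∧ not w ⟧ + codim M W) * t ^ (⟦ q ∧ not m ⟧ + codim Q M))))
             ≡ coef m * S
  half m = trans (∑-ext (allSubsets n) λ M → trans
      (cong₂ _*_ (trans (cong ⟦_⟧ (⊆ᵇ-∷ w m W M)) (⟦∧⟧ (not w ∨ m) (W ⊆ᵇ M)))
        (cong₂ _*_ (trans (cong ⟦_⟧ (⊆ᵇ-∷ m q M Q)) (⟦∧⟧ (not m ∨ q) (M ⊆ᵇ Q)))
          (cong₂ _*_ (^-distribˡ-+-* s ⟦ m ∧ not w ⟧ (codim M W)) (^-distribˡ-+-* t ⟦ q ∧ not m ⟧ (codim Q M)))))
      (solve 8 (λ a b c d e f g h → (a :* b) :* ((c :* d) :* ((e :* f) :* (g :* h)))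
                                 := (a :* (c :* (e :* g))) :* (b :* (d :* (f :* h)))) refl
        ⟦ not w ∨ m ⟧ ⟦ W ⊆ᵇ M ⟧ ⟦ not m ∨ q ⟧ ⟦ M ⊆ᵇ Q ⟧ (s ^ ⟦ m ∧ not w ⟧) (s ^ codim M W) (t ^ ⟦ q ∧ not m ⟧) (t ^ codim Q M)))
    (trans (∑-*ˡ (coef m) _ (allSubsets n)) (cong (coef m *_) (interval-binomial s t W Q)))
  sums : ∀ w q →
    ⟦ not w ∨ false ⟧ * (⟦ not false ∨ q ⟧ * (s ^ ⟦ false ∧ not w ⟧ * t ^ ⟦ q ∧ not false ⟧)) * S
    + ⟦ not w ∨ true ⟧ * (⟦ not true ∨ q ⟧ * (s ^ ⟦ true ∧ not w ⟧ * t ^ ⟦ q ∧ not true ⟧)) * S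
    ≡ ⟦ (not w ∨ q) ∧ (W ⊆ᵇ Q) ⟧ * (s + t) ^ (⟦ q ∧ not w ⟧ + codim Q W)
  sums false false = trans (+-identityʳ _) (+-identityʳ S)
  sums false true = solve 4 (λ s t b p → (con 1 :* (con 1 :* (con 1 :* (t :* con 1)))) :* (b :* p)
      :+ (con 1 :* (con 1 :* ((s :* con 1) :* con 1))) :* (b :* p) := b :* ((s :+ t) :* p)) refl s t ⟦ W ⊆ᵇ Q ⟧ _
  sums true false = refl
  sums true true = +-identityʳ S

∑-delta : (e : A → A → Bool) → (∀ {x y} → e x y ≡ true → x ≡ y) → (∀ x → e x x ≡ true) →
          (f : A → ℕ) {xs : List A} {x : A} → Unique xs → x ∈ˡ xs → ∑ xs (λ y → ⟦ e x y ⟧ * f y) ≡ f x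
∑-delta e e⇒≡ e-refl f {x ∷ xs} (x∉ ∷ u) (here refl) = trans
  (cong₂ _+_ (trans (cong (λ b → ⟦ b ⟧ * f x) (e-refl x)) (+-identityʳ (f x)))
    (trans (∑-cong xs λ y i → cong (λ b → ⟦ b ⟧ * f y) (¬-not λ exy → All.lookup x∉ i (e⇒≡ exy))) (∑-zero xs)))
  (+-identityʳ (f x))
∑-delta e e⇒≡ e-refl f {y ∷ xs} {x} (y∉ ∷ u) (there i) = trans
  (cong (λ b → ⟦ b ⟧ * f y + ∑ xs (λ z → ⟦ e x z ⟧ * f z)) (¬-not λ exy → All.lookup y∉ i (sym (e⇒≡ exy))))
  (∑-delta e e⇒≡ e-refl f u i)

infix 4 _≐ᵇ_

_≐ᵇ_ : Subset n → Subset n → Bool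
I ≐ᵇ J = (I ⊆ᵇ J) ∧ (J ⊆ᵇ I)

≐ᵇ⇒≡ : (I J : Subset n) → (I ≐ᵇ J) ≡ true → I ≡ J
≐ᵇ⇒≡ I J e = ⊆-antisym I J (⊆ᵇ-true⁻ I J (proj₁ (∧-true⁻ e))) (⊆ᵇ-true⁻ J I (proj₂ (∧-true⁻ {I ⊆ᵇ J} e)))

≐ᵇ-refl : (I : Subset n) → (I ≐ᵇ I) ≡ true
≐ᵇ-refl I = ∧-true (⊆ᵇ-true I I (⊆-refl I)) (⊆ᵇ-true I I (⊆-refl I))

∑-delta-subset : (f : Subset n → ℕ) (I : Subset n) → ∑ (allSubsets n) (λ J → ⟦ I ≐ᵇ J ⟧ * f J) ≡ f I
∑-delta-subset f I = ∑-delta _≐ᵇ_ (λ {I} {J} → ≐ᵇ⇒≡ I J) ≐ᵇ-refl f (allSubsets-unique _) (∈-allSubsets I)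

-- The recursion (*) and the uniqueness of its solution

Recursive : ℕ → (Subset n → ℕ) → (Subset n → ℕ) → Set
Recursive {n} t c f = ∀ U → ∑ (allSubsets n) (λ U′ → ⟦ U′ ⊆ᵇ U ⟧ * (t ^ c U′ * f U′)) ≡ (1 + t) ^ c U * f U

-- Both equations say that `s` is `p - q` times the unknown. Here `q` and `p` are the powers of `t`
-- and `1 + t` at `U` itself, and `s` collects the proper subsets.
cancel-growth : ∀ {p q s a b} → q < p → q * a + s ≡ p * a → q * b + s ≡ p * b → a ≡ b
cancel-growth {p} {q} {s} {a} {b} q<p ea eb with m≤n⇒∃[o]m+o≡n q<p
... | r , refl = *-cancelˡ-≡ a b (suc r) (trans (sym (rest a ea)) (rest b eb))
  where
  rest : ∀ a → q * a + s ≡ (suc q + r) * a → s ≡ suc r * a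
  rest a e = +-cancelˡ-≡ (q * a) s (suc r * a) (trans e
    (solve 3 (λ q r a → (con 1 :+ q :+ r) :* a := q :* a :+ (con 1 :+ r) :* a) refl q r a))

-- Induction on the cardinality of `U`: once the term `U′ = U` is split off by `peel`, the rest of
-- the sum runs over proper subsets, where `f` and `g` already agree.
recursive-unique : ∀ t {c f g : Subset n → ℕ} → Recursive t c f → Recursive t c g →
                   (∀ U → c U ≡ 0 → f U ≡ g U) → ∀ U → f U ≡ g U
recursive-unique {n} t {c} {f} {g} rf rg base U =
  <-rec (λ k → ∀ U → ∣ U ∣ ≡ k → f U ≡ g U) go ∣ U ∣ U refl
  where
  split : ∀ h (U U′ : Subset n) → ⟦ U′ ⊆ᵇ U ⟧ * h ≡ ⟦ U ≐ᵇ U′ ⟧ * h + ⟦ U′ ⊂ᵇ U ⟧ * h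
  split h U U′ with U′ ⊆ᵇ U | U ⊆ᵇ U′
  ... | true | true = sym (+-identityʳ _)
  ... | true | false = refl
  ... | false | true = refl
  ... | false | false = refl
  peel : ∀ {f} → Recursive t c f → ∀ U →
         t ^ c U * f U + ∑ (allSubsets n) (λ U′ → ⟦ U′ ⊂ᵇ U ⟧ * (t ^ c U′ * f U′)) ≡ (1 + t) ^ c U * f U
  peel {f} r U = trans (cong (_+ ∑ (allSubsets n) (λ U′ → ⟦ U′ ⊂ᵇ U ⟧ * (t ^ c U′ * f U′))) (sym (∑-delta-subset (λ U′ → t ^ c U′ * f U′) U)))
    (trans (sym (∑-+ _ _ (allSubsets n))) (trans (∑-ext (allSubsets n) λ U′ → sym (split (t ^ c U′ * f U′) U U′)) (r U)))
  go : ∀ k → (∀ {l} → l < k → ∀ U → ∣ U ∣ ≡ l → f U ≡ g U) → ∀ U → ∣ U ∣ ≡ k → f U ≡ g U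
  go k ih U refl with c U in eq
  -- Both powers equal 1 here, so the equation at `U` leaves `f U` undetermined.
  ... | zero = base U eq
  ... | suc l = cancel-growth (^-monoˡ-< (c U) {{subst NonZero (sym eq) _}} (n<1+n t)) (peel rf U)
    (trans (cong (t ^ c U * g U +_) (∑-ext (allSubsets n) λ U′ →
      ⟦⟧-cong-* (U′ ⊂ᵇ U) λ e → cong (t ^ c U′ *_) (ih (⊊⇒∣∣< U′ U (⊂ᵇ-true⁻ U′ U e)) U′ refl))) (peel rg U))

-- Comparing coefficients

digits : ∀ t {a b c d} → a < t → c < t → a + t * b ≡ c + t * d → a ≡ c × b ≡ d
digits (suc t) {a} {b} {c} {d} a<t c<t e = a≡c , *-cancelˡ-≡ b d (suc t) (+-cancelˡ-≡ a _ _ (trans e (cong (_+ _) (sym a≡c))))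
  where
  rem : ∀ {a b} → a < suc t → (a + suc t * b) % suc t ≡ a
  rem {a} {b} lt = trans (cong (λ z → (a + z) % suc t) (*-comm (suc t) b)) (trans ([m+kn]%n≡m%n a b (suc t)) (m<n⇒m%n≡m lt))
  a≡c : a ≡ c
  a≡c = trans (sym (rem {a} {b} a<t)) (trans (cong (_% suc t) e) (rem {c} {d} c<t))

-- With a list of exponents read as a sum of powers of `t`, this removes the constant term and
-- divides by `t`.
preds : List ℕ → List ℕ
preds [] = []
preds (zero ∷ xs) = preds xs
preds (suc x ∷ xs) = x ∷ preds xs

length-preds : ∀ xs → length (preds xs) ≤ length xs
length-preds [] = z≤n
length-preds (zero ∷ xs) = m≤n⇒m≤1+n (length-preds xs)
length-preds (suc x ∷ xs) = s≤s (length-preds xs)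

occ : ℕ → List ℕ → ℕ
occ k xs = ∑ xs (λ x → ⟦ x ≡ᵇ k ⟧)

occ-≤ : ∀ k xs → occ k xs ≤ length xs
occ-≤ k [] = z≤n
occ-≤ k (x ∷ xs) with x ≡ᵇ k
... | true = s≤s (occ-≤ k xs)
... | false = m≤n⇒m≤1+n (occ-≤ k xs)

occ-preds : ∀ k xs → occ (suc k) xs ≡ occ k (preds xs)
occ-preds k [] = refl
occ-preds k (zero ∷ xs) = occ-preds k xs
occ-preds k (suc x ∷ xs) = cong (⟦ x ≡ᵇ k ⟧ +_) (occ-preds k xs)

∑-^-preds : ∀ t xs → ∑ xs (t ^_) ≡ occ 0 xs + t * ∑ (preds xs) (t ^_)
∑-^-preds t [] = sym (*-zeroʳ t)
∑-^-preds t (zero ∷ xs) = cong suc (∑-^-preds t xs)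
∑-^-preds t (suc x ∷ xs) = trans (cong (t * t ^ x +_) (∑-^-preds t xs))
  (solve 4 (λ t a b c → t :* a :+ (b :+ t :* c) := b :+ t :* (a :+ c)) refl t (t ^ x) (occ 0 xs) _)

-- A base exceeding both lengths makes the multiplicities the base-t digits.
occ-unique : ∀ t k xs ys → length xs < t → length ys < t → ∑ xs (t ^_) ≡ ∑ ys (t ^_) → occ k xs ≡ occ k ys
occ-unique t k xs ys lx ly e
  with digits t (≤-<-trans (occ-≤ 0 xs) lx) (≤-<-trans (occ-≤ 0 ys) ly)
         (trans (sym (∑-^-preds t xs)) (trans e (∑-^-preds t ys)))
occ-unique t zero xs ys lx ly e | e₀ , _ = e₀
occ-unique t (suc k) xs ys lx ly e | _ , e₁ =
  trans (occ-preds k xs) (trans (occ-unique t k (preds xs) (preds ys)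
    (≤-<-trans (length-preds xs) lx) (≤-<-trans (length-preds ys) ly) e₁) (sym (occ-preds k ys)))

countᵇ≡∑ : (p : A → Bool) (xs : List A) → countᵇ p xs ≡ ∑ xs (λ x → ⟦ p x ⟧)
countᵇ≡∑ p [] = refl
countᵇ≡∑ p (x ∷ xs) with p x
... | true = cong suc (countᵇ≡∑ p xs)
... | false = countᵇ≡∑ p xs

countᵇ-cong : {p q : A → Bool} → (∀ x → p x ≡ q x) → (xs : List A) → countᵇ p xs ≡ countᵇ q xs
countᵇ-cong {p = p} {q} e xs = trans (countᵇ≡∑ p xs) (trans (∑-ext xs λ x → cong ⟦_⟧ (e x)) (sym (countᵇ≡∑ q xs)))

≡ᵇ-∸ : ∀ s i d → i ≤ d → (s + i ≡ᵇ d) ≡ (s ≡ᵇ d ∸ i)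
≡ᵇ-∸ s zero d z≤n = cong (_≡ᵇ d) (+-identityʳ s)
≡ᵇ-∸ s (suc i) (suc d) (s≤s le) = trans (cong (_≡ᵇ suc d) (+-suc s i)) (≡ᵇ-∸ s i d le)

≡ᵇ-> : ∀ s i d → d < i → (s + i ≡ᵇ d) ≡ false
≡ᵇ-> s (suc i) zero lt = cong (_≡ᵇ 0) (+-suc s i)
≡ᵇ-> s (suc i) (suc d) (s≤s lt) = trans (cong (_≡ᵇ suc d) (+-suc s i)) (≡ᵇ-> s i d lt)

-- For `i ≤ d` the two sums are evaluated at a base exceeding both numbers of terms, where the digit
-- in position `d ∸ i` is the count in question. For `i > d` both counts vanish.
genfun-count : (p : A → Bool) (s : A → ℕ) (as : List A) (q : C → Bool) (r : C → ℕ) (bs : List C) →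
  (∀ t → ∑ as (λ a → ⟦ p a ⟧ * t ^ s a) ≡ ∑ bs (λ b → ⟦ q b ⟧ * t ^ r b)) →
  ∀ d i → countᵇ (λ a → p a ∧ (s a + i ≡ᵇ d)) as ≡ countᵇ (λ b → q b ∧ (r b + i ≡ᵇ d)) bs
genfun-count {A} {C} p s as q r bs e d i with <-≤-connex d i
... | inj₁ d<i = trans (none p s as) (sym (none q r bs))
  where
  none : {B : Set} (p : B → Bool) (s : B → ℕ) (xs : List B) → countᵇ (λ a → p a ∧ (s a + i ≡ᵇ d)) xs ≡ 0
  none p s xs = trans (countᵇ≡∑ _ xs) (trans (∑-ext xs λ x → trans (⟦∧⟧ (p x) _)
    (trans (cong (λ b → ⟦ p x ⟧ * ⟦ b ⟧) (≡ᵇ-> (s x) i d d<i)) (*-zeroʳ ⟦ p x ⟧))) (∑-zero xs))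
... | inj₂ i≤d = trans (some p s as) (trans
    (occ-unique t (d ∸ i) (map s (filterᵇ p as)) (map r (filterᵇ q bs)) (s≤s (m≤m+n _ _)) (s≤s (m≤n+m _ _)) (trans (pow p s as) (trans (e t) (sym (pow q r bs)))))
    (sym (some q r bs)))
  where
  t = suc (length (map s (filterᵇ p as)) + length (map r (filterᵇ q bs)))
  some : {B : Set} (p : B → Bool) (s : B → ℕ) (xs : List B) →
         countᵇ (λ a → p a ∧ (s a + i ≡ᵇ d)) xs ≡ occ (d ∸ i) (map s (filterᵇ p xs))
  some p s xs = trans (countᵇ≡∑ _ xs) (trans (∑-ext xs λ x → trans (⟦∧⟧ (p x) _)
    (cong (λ b → ⟦ p x ⟧ * ⟦ b ⟧) (≡ᵇ-∸ (s x) i d i≤d)))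
    (sym (trans (∑-map _ s (filterᵇ p xs)) (∑-filterᵇ p _ xs))))
  pow : {B : Set} (p : B → Bool) (s : B → ℕ) (xs : List B) →
        ∑ (map s (filterᵇ p xs)) (t ^_) ≡ ∑ xs (λ a → ⟦ p a ⟧ * t ^ s a)
  pow p s xs = trans (∑-map _ s (filterᵇ p xs)) (∑-filterᵇ p _ xs)

-- Connected sets of vertices

eqFin⇒≡ : {i j : Fin n} → eqFin i j ≡ true → i ≡ j
eqFin⇒≡ {i = i} {j} e with i ≟ j
... | yes p = p
... | no _ with () ← e

eqFin-refl : (i : Fin n) → eqFin i i ≡ true
eqFin-refl i with i ≟ i
... | yes _ = refl
... | no ne = contradiction refl ne

∈-singleton : (i : Fin n) → i ∈ singleton i
∈-singleton i = ∈-tabulate (λ j → eqFin j i) i (eqFin-refl i)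

∈-singleton⁻ : (i j : Fin n) → i ∈ singleton j → i ≡ j
∈-singleton⁻ i j e = eqFin⇒≡ (∈-tabulate⁻ (λ k → eqFin k j) i e)

-- Only the vertices after the start must lie in `I`. This matches `reachIn`, which begins with the
-- singleton of `u` whether or not `u` is in `I`, and it is why symmetry asks for `u ∈ I`.
data Reach (H : Graph n) (I : Subset n) (u : Fin n) : Fin n → Set where
  done : Reach H I u u
  step▷ : ∀ {v w} → Reach H I u v → H v w ≡ true → w ∈ I → Reach H I u w

module _ {H : Graph n} where

  reach-trans : ∀ {I u v w} → Reach H I u v → Reach H I v w → Reach H I u w
  reach-trans r done = r
  reach-trans r (step▷ s h e) = step▷ (reach-trans r s) h e

  reach-mono : ∀ I J {u v} → I ⊆ J → Reach H I u v → Reach H J u v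
  reach-mono I J f done = done
  reach-mono I J f (step▷ r h e) = step▷ (reach-mono I J f r) h (f _ e)

  reach-∈ : ∀ {I u v} → u ∈ I → Reach H I u v → v ∈ I
  reach-∈ e done = e
  reach-∈ _ (step▷ _ _ e) = e

  reach-sym : (∀ i j → H i j ≡ H j i) → ∀ {I u v} → u ∈ I → Reach H I u v → Reach H I v u
  reach-sym Hs e done = done
  reach-sym Hs e (step▷ {v} {w} r h _) =
    reach-trans (step▷ done (trans (Hs w v) h) (reach-∈ e r)) (reach-sym Hs e r)

module _ (H : Graph n) (I : Subset n) (u : Fin n) where

  private
    R : ℕ → Subset n
    R k = iter k (step H I) (singleton u)

    grow : Subset n → Fin n → Bool
    grow R w = mem w R ∨ (mem w I ∧ any (λ u → mem u R ∧ H u w) (allFin n))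

  step-⊇ : ∀ R → R ⊆ step H I R
  step-⊇ R i e = ∈-tabulate (grow R) i (∨-trueˡ e)

  step-∈ : ∀ {v w} R → v ∈ R → H v w ≡ true → w ∈ I → w ∈ step H I R
  step-∈ {v} {w} R e h wI = ∈-tabulate (grow R) w (∨-trueʳ {mem w R} (∧-true wI (any-true {p = λ u → mem u R ∧ H u w} (∈-allFin v) (∧-true e h))))

  step-∈⁻ : ∀ {w} R → w ∈ step H I R → w ∈ R ⊎ (w ∈ I × ∃ λ v → v ∈ R × H v w ≡ true)
  step-∈⁻ {w} R e with ∨-true⁻ {mem w R} (∈-tabulate⁻ (grow R) w e)
  ... | inj₁ p = inj₁ p
  ... | inj₂ p with ∧-true⁻ {mem w I} p
  ...   | wI , a with any-true⁻ {xs = allFin n} a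
  ...     | v , _ , q = inj₂ (wI , v , ∧-true⁻ {mem v R} q)

  iter-sound : ∀ k w → w ∈ R k → Reach H I u w
  iter-sound zero w e with refl ← ∈-singleton⁻ w u e = done
  iter-sound (suc k) w e with step-∈⁻ (R k) e
  ... | inj₁ p = iter-sound k w p
  ... | inj₂ (wI , v , vR , h) = step▷ (iter-sound k v vR) h wI

  closed-complete : ∀ R {v} → step H I R ⊆ R → u ∈ R → Reach H I u v → v ∈ R
  closed-complete R c e done = e
  closed-complete R c e (step▷ r h wI) = c _ (step-∈ R (closed-complete R c e r) h wI)

  iter-∋ : ∀ k → u ∈ R k
  iter-∋ zero = ∈-singleton u
  iter-∋ (suc k) = step-⊇ (R k) u (iter-∋ k)

  -- The reason why `n` rounds suffice in `reachIn`: a round that does not close the set adds a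
  -- vertex, so a set still open after `n` rounds would have more than `n` elements.
  iter-closed : ∀ k → step H I (R k) ⊆ R k ⊎ k < ∣ R k ∣
  iter-closed zero = inj₂ (≤-trans (s≤s z≤n) (⊊⇒∣∣< ∅ (R 0) ((λ i e → contradiction e (∉∅ i)) , λ f → ∉∅ u (f u (iter-∋ 0)))))
  iter-closed (suc k) with R (suc k) ⊆? R k
  ... | yes c = inj₁ λ i e → subst (λ S → i ∈ step H I S) (⊆-antisym (R (suc k)) (R k) c (step-⊇ (R k))) e
  ... | no nc with iter-closed k
  ...   | inj₁ c = contradiction c nc
  ...   | inj₂ lt = inj₂ (≤-<-trans lt (⊊⇒∣∣< (R k) (R (suc k)) (step-⊇ (R k) , nc)))

  reachIn-sound : ∀ w → w ∈ reachIn H I u → Reach H I u w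
  reachIn-sound = iter-sound n

  reachIn-complete : ∀ {w} → Reach H I u w → w ∈ reachIn H I u
  reachIn-complete r with iter-closed n
  ... | inj₁ c = closed-complete (R n) c (iter-∋ n) r
  ... | inj₂ lt = contradiction (∣p∣≤n (R n)) (<⇒≱ lt)

module _ (H : Graph n) where

  inB-intro : ∀ I u → u ∈ I → (∀ v w → v ∈ I → w ∈ I → Reach H I v w) → inB H I ≡ true
  inB-intro I u e r = ∧-true (any-true {p = λ i → mem i I} (∈-allFin u) e)
    (all-true {xs = allFin n} {p = λ u → not (mem u I) ∨ (I ⊆ᵇ reachIn H I u)} λ {v} _ → implies-true λ vI → ⊆ᵇ-true I (reachIn H I v) λ w wI → reachIn-complete H I v (r v w vI wI))

  inB-nonempty : ∀ I → inB H I ≡ true → ∃ λ u → u ∈ I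
  inB-nonempty I e with any-true⁻ {xs = allFin n} (proj₁ (∧-true⁻ {nonemptyᵇ I} e))
  ... | u , _ , p = u , p

  inB-reach : ∀ I → inB H I ≡ true → ∀ v w → v ∈ I → w ∈ I → Reach H I v w
  inB-reach I e v w vI wI = reachIn-sound H I v w (⊆ᵇ-true⁻ I (reachIn H I v)
    (implies-true⁻ (all-true⁻ {p = λ u → not (mem u I) ∨ (I ⊆ᵇ reachIn H I u)} (proj₂ (∧-true⁻ {nonemptyᵇ I} e)) (∈-allFin v)) vI) w wI)

  inB-singleton : ∀ u → inB H (singleton u) ≡ true
  inB-singleton u = inB-intro (singleton u) u (∈-singleton u) pairs
    where
    pairs : ∀ v w → v ∈ singleton u → w ∈ singleton u → Reach H (singleton u) v w
    pairs v w e f with refl ← ∈-singleton⁻ v u e | refl ← ∈-singleton⁻ w u f = done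

infixl 6 _∪_

_∪_ : Subset n → Subset n → Subset n
_∪_ = zipWith _∨_

∪-inˡ : (I J : Subset n) → I ⊆ I ∪ J
∪-inˡ I J i e = trans (lookup-zipWith _∨_ i I J) (∨-trueˡ e)

∪-inʳ : (I J : Subset n) → J ⊆ I ∪ J
∪-inʳ I J i e = trans (lookup-zipWith _∨_ i I J) (∨-trueʳ {mem i I} e)

∪-case : (I J : Subset n) → ∀ i → i ∈ I ∪ J → i ∈ I ⊎ i ∈ J
∪-case I J i e = ∨-true⁻ (trans (sym (lookup-zipWith _∨_ i I J)) e)

inB-∪ : (H : Graph n) (I J : Subset n) → inB H I ≡ true → inB H J ≡ true →
        ∀ i → i ∈ I → i ∈ J → inB H (I ∪ J) ≡ true
inB-∪ H I J bI bJ i iI iJ = inB-intro H (I ∪ J) i (∪-inˡ I J i iI) λ v w vU wU →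
  reach-trans (to v vU) (from w wU)
  where
  to : ∀ v → v ∈ I ∪ J → Reach H (I ∪ J) v i
  to v e with ∪-case I J v e
  ... | inj₁ vI = reach-mono I (I ∪ J) (∪-inˡ I J) (inB-reach H I bI v i vI iI)
  ... | inj₂ vJ = reach-mono J (I ∪ J) (∪-inʳ I J) (inB-reach H J bJ v i vJ iJ)
  from : ∀ v → v ∈ I ∪ J → Reach H (I ∪ J) i v
  from v e with ∪-case I J v e
  ... | inj₁ vI = reach-mono I (I ∪ J) (∪-inˡ I J) (inB-reach H I bI i v iI vI)
  ... | inj₂ vJ = reach-mono J (I ∪ J) (∪-inʳ I J) (inB-reach H J bJ i v iJ vJ)

-- Nested families

argmax : (f : A → ℕ) (p : A → Bool) (xs : List A) →
         (∃ λ y → y ∈ˡ xs × p y ≡ true × (∀ z → z ∈ˡ xs → p z ≡ true → f z ≤ f y))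
         ⊎ (∀ z → z ∈ˡ xs → p z ≢ true)
argmax f p [] = inj₂ λ _ ()
argmax f p (x ∷ xs) with true? (p x) | argmax f p xs
... | yes px | inj₂ none = inj₁ (x , here refl , px , λ
  { z (here refl) _ → ≤-refl ; z (there i) pz → contradiction pz (none z i) })
... | no npx | inj₂ none = inj₂ λ { z (here refl) → npx ; z (there i) → none z i }
... | no npx | inj₁ (y , i , py , max) = inj₁ (y , there i , py , λ
  { z (here refl) pz → contradiction pz npx ; z (there j) pz → max z j pz })
... | yes px | inj₁ (y , i , py , max) with ≤-total (f x) (f y)
...   | inj₁ le = inj₁ (y , there i , py , λ { z (here refl) _ → le ; z (there j) pz → max z j pz })
...   | inj₂ ge = inj₁ (x , here refl , px , λ { z (here refl) _ → ≤-refl ; z (there j) pz → ≤-trans (max z j pz) ge })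

pairwiseDisjoint-true : {S : List (Subset n)} → Unique S →
  (∀ I J → I ∈ˡ S → J ∈ˡ S → I ≢ J → Disjoint I J) → pairwiseDisjoint S ≡ true
pairwiseDisjoint-true [] f = refl
pairwiseDisjoint-true {S = I ∷ S} (I∉ ∷ u) f = ∧-true
  (all-true {xs = S} {p = disjointᵇ I} λ {J} j → disjointᵇ-true I J (f I J (here refl) (there j) (All.lookup I∉ j)))
  (pairwiseDisjoint-true u λ J K j k → f J K (there j) (there k))

pairwiseDisjoint-other : (S : List (Subset n)) → pairwiseDisjoint S ≡ true → (2 ≤ᵇ length S) ≡ true →
  ∀ I → I ∈ˡ S → ∃ λ J → J ∈ˡ S × Disjoint I J
pairwiseDisjoint-other (A ∷ []) pd ()
pairwiseDisjoint-other (A ∷ B ∷ S) pd _ I (here refl) =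
  B , there (here refl) , disjointᵇ-true⁻ A B (all-true⁻ {xs = B ∷ S} {p = disjointᵇ A} (proj₁ (∧-true⁻ pd)) (here refl))
pairwiseDisjoint-other (A ∷ B ∷ S) pd _ I (there i) =
  A , here refl , λ k a b → disjointᵇ-true⁻ A I (all-true⁻ {xs = B ∷ S} {p = disjointᵇ A} (proj₁ (∧-true⁻ pd)) i) k b a

two-members : {xs : List A} {x y : A} → x ∈ˡ xs → y ∈ˡ xs → x ≢ y → (2 ≤ᵇ length xs) ≡ true
two-members (here refl) (here refl) ne = contradiction refl ne
two-members {xs = _ ∷ _ ∷ _} _ _ _ = refl

_∈ˡ?_ : (I : Subset n) (N : List (Subset n)) → Dec (I ∈ˡ N)
_∈ˡ?_ = ∈?-via (≡-dec Bool._≟_)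

module _ (H : Graph n) where

  nestedᵇ : List (Subset n) → Bool
  nestedᵇ N = all (inB H) N ∧ pairwiseOK N ∧ unionOK H N

  -- In a laminar family, a forbidden disjoint union K exists iff some K ∈ 𝓑 is covered by the
  -- members properly inside K: pass to the maximal ones among them.
  record Nested (N : List (Subset n)) : Set where
    field
      tubes : ∀ I → I ∈ˡ N → inB H I ≡ true
      laminar : ∀ I J → I ∈ˡ N → J ∈ˡ N → I ⊆ J ⊎ J ⊆ I ⊎ Disjoint I J
      uncovered : ∀ K → inB H K ≡ true → ¬ (∀ i → i ∈ K → ∃ λ I → I ∈ˡ N × i ∈ I × I ⊊ K)
  open Nested

  -- In a disjoint subfamily with at least two members, each member misses a second, nonempty one
  -- and is therefore properly contained in the union. The subfamily would thus be a cover of the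
  -- kind that `uncovered` excludes.
  Nested⇒nestedᵇ : ∀ N → Nested N → nestedᵇ N ≡ true
  Nested⇒nestedᵇ N nest = ∧-true (all-true {xs = N} λ {I} → tubes nest I)
    (∧-true (all-true {xs = N} λ {I} i → all-true {xs = N} λ {J} j → ok I J (laminar nest I J i j))
      (all-true {xs = sublists N} λ {S} s → not-true (bad S s)))
    where
    ok : ∀ I J → I ⊆ J ⊎ J ⊆ I ⊎ Disjoint I J → ((I ⊆ᵇ J) ∨ (J ⊆ᵇ I) ∨ disjointᵇ I J) ≡ true
    ok I J (inj₁ f) = ∨-trueˡ (⊆ᵇ-true I J f)
    ok I J (inj₂ (inj₁ f)) = ∨-trueʳ {I ⊆ᵇ J} (∨-trueˡ (⊆ᵇ-true J I f))
    ok I J (inj₂ (inj₂ f)) = ∨-trueʳ {I ⊆ᵇ J} (∨-trueʳ {J ⊆ᵇ I} (disjointᵇ-true I J f))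
    bad : ∀ S → S ∈ˡ sublists N → (2 ≤ᵇ length S) ∧ pairwiseDisjoint S ∧ inB H (unionAll S) ≢ true
    bad S s e with ∧-true⁻ {2 ≤ᵇ length S} e
    ... | two , e′ with ∧-true⁻ {pairwiseDisjoint S} e′
    ...   | pd , b = uncovered nest (unionAll S) b cover
      where
      cover : ∀ i → i ∈ unionAll S → ∃ λ I → I ∈ˡ N × i ∈ I × I ⊊ unionAll S
      cover i iS with ∈-unionAll⁻ S iS
      ... | I , I∈S , i∈I with pairwiseDisjoint-other S pd two I I∈S
      ...   | J , J∈S , dis with inB-nonempty H J (tubes nest J (sublists-⊆ {ys = N} s J∈S))
      ...     | j , j∈J = I , sublists-⊆ {ys = N} s I∈S , i∈I , (λ k → ∈-unionAll I∈S) ,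
        λ f → dis j (f j (∈-unionAll J∈S j∈J)) j∈J

  -- A cover of `K` by members properly inside it is thinned to the maximal ones, which laminarity
  -- makes disjoint and whose union is still `K`. Since `pairwiseDisjoint` compares list entries,
  -- `Unique N` ensures that different entries are different sets.
  nestedᵇ⇒Nested : ∀ N → Unique N → nestedᵇ N ≡ true → Nested N
  nestedᵇ⇒Nested N u e with ∧-true⁻ {all (inB H) N} e
  ... | eB , e′ with ∧-true⁻ {pairwiseOK N} e′
  ...   | eL , eU = record { tubes = λ I → all-true⁻ eB ; laminar = lam ; uncovered = unc }
    where
    lam : ∀ I J → I ∈ˡ N → J ∈ˡ N → I ⊆ J ⊎ J ⊆ I ⊎ Disjoint I J
    lam I J i j with ∨-true⁻ {I ⊆ᵇ J} (all-true⁻ {p = λ J → (I ⊆ᵇ J) ∨ (J ⊆ᵇ I) ∨ disjointᵇ I J}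
                   (all-true⁻ {p = λ I → all (λ J → (I ⊆ᵇ J) ∨ (J ⊆ᵇ I) ∨ disjointᵇ I J) N} eL i) j)
    ... | inj₁ a = inj₁ (⊆ᵇ-true⁻ I J a)
    ... | inj₂ b with ∨-true⁻ {J ⊆ᵇ I} b
    ...   | inj₁ c = inj₂ (inj₁ (⊆ᵇ-true⁻ J I c))
    ...   | inj₂ d = inj₂ (inj₂ (disjointᵇ-true⁻ I J d))
    unc : ∀ K → inB H K ≡ true → ¬ (∀ i → i ∈ K → ∃ λ I → I ∈ˡ N × i ∈ I × I ⊊ K)
    unc K bK cover = not-true⁻ (all-true⁻ {p = λ S → not ((2 ≤ᵇ length S) ∧ pairwiseDisjoint S ∧ inB H (unionAll S))}
                                  eU (filterᵇ∈sublists maximal N))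
      (∧-true (two (inB-nonempty H K bK)) (∧-true disj (subst (λ X → inB H X ≡ true) (sym union) bK)))
      where
      above : Subset n → Subset n → Bool
      above I J = (J ⊂ᵇ K) ∧ (I ⊂ᵇ J)
      maximal : Subset n → Bool
      maximal I = (I ⊂ᵇ K) ∧ all (λ J → not (above I J)) N
      S = filterᵇ maximal N
      S⊊K : ∀ I → I ∈ˡ S → I ⊊ K
      S⊊K I i = ⊂ᵇ-true⁻ I K (proj₁ (∧-true⁻ {I ⊂ᵇ K} (proj₂ (∈-filterᵇ⁻ maximal N i))))
      S-max : ∀ I J → I ∈ˡ S → J ∈ˡ N → J ⊊ K → ¬ I ⊊ J
      S-max I J i j jK ij = not-true⁻ (all-true⁻ {p = λ J → not (above I J)}
        (proj₂ (∧-true⁻ {I ⊂ᵇ K} (proj₂ (∈-filterᵇ⁻ maximal N i)))) j) (∧-true (⊂ᵇ-true J K jK) (⊂ᵇ-true I J ij))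
      S⊆N : ∀ I → I ∈ˡ S → I ∈ˡ N
      S⊆N I i = proj₁ (∈-filterᵇ⁻ maximal N i)
      -- Among the members properly inside `K` that contain `i`, one of largest cardinality is
      -- maximal under inclusion: a member strictly above it would contain `i` as well.
      covered : ∀ i → i ∈ K → ∃ λ I → I ∈ˡ S × i ∈ I
      covered i iK with argmax ∣_∣ (λ I → mem i I ∧ (I ⊂ᵇ K)) N
      ... | inj₂ none with cover i iK
      ...   | I , I∈N , i∈I , I⊊K = contradiction (∧-true i∈I (⊂ᵇ-true I K I⊊K)) (none I I∈N)
      covered i iK | inj₁ (I , I∈N , pI , max) with ∧-true⁻ {mem i I} pI
      ... | i∈I , I⊂K = I , ∈-filterᵇ maximal I∈N (∧-true I⊂K (all-true {xs = N} λ {J} J∈N → not-true λ ab →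
        let (jK , ij) = ∧-true⁻ {J ⊂ᵇ K} ab ; I⊊J = ⊂ᵇ-true⁻ I J ij in
        <⇒≱ (⊊⇒∣∣< I J I⊊J) (max J J∈N (∧-true (proj₁ I⊊J i i∈I) jK)))) , i∈I
      union : unionAll S ≡ K
      union = ⊆-antisym (unionAll S) K
        (λ i e → let (I , I∈S , i∈I) = ∈-unionAll⁻ S e in proj₁ (S⊊K I I∈S) i i∈I)
        (λ i e → let (I , I∈S , i∈I) = covered i e in ∈-unionAll I∈S i∈I)
      ⊆⇒≡ : ∀ I J → I ∈ˡ S → J ∈ˡ S → I ⊆ J → I ≡ J
      ⊆⇒≡ I J i j f with J ⊆? I
      ... | yes g = ⊆-antisym I J f g
      ... | no ng = contradiction (f , ng) (S-max I J i (S⊆N J j) (S⊊K J j))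
      disj : pairwiseDisjoint S ≡ true
      disj = pairwiseDisjoint-true (filterᵇ-unique maximal u) λ I J i j ne → dis I J i j ne (lam I J (S⊆N I i) (S⊆N J j))
        where
        dis : ∀ I J → I ∈ˡ S → J ∈ˡ S → I ≢ J → I ⊆ J ⊎ J ⊆ I ⊎ Disjoint I J → Disjoint I J
        dis I J i j ne (inj₁ f) = contradiction (⊆⇒≡ I J i j f) ne
        dis I J i j ne (inj₂ (inj₁ f)) = contradiction (sym (⊆⇒≡ J I j i f)) ne
        dis I J i j ne (inj₂ (inj₂ d)) = d
      -- One maximal member is proper in `K`, so a point of `K` outside it must be covered by
      -- another one.
      two : (∃ λ i → i ∈ K) → (2 ≤ᵇ length S) ≡ true
      two (i , iK) with covered i iK
      ... | I , I∈S , _ with ⊈⇒∃ K I (proj₂ (S⊊K I I∈S))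
      ...   | j , jK , j∉I with covered j jK
      ...     | J , J∈S , j∈J = two-members I∈S J∈S λ { refl → j∉I j∈J }

  -- Connected components of induced subgraphs

  -- The components of the subgraph induced on `U`, written as the maximal elements of the building
  -- set below `U`. The shape follows `isMax`, with which it agrees at `U = full`.
  isComp : Subset n → Subset n → Bool
  isComp U C = inB H C ∧ (C ⊆ᵇ U) ∧ not (any (λ J → inB H J ∧ (J ⊆ᵇ U) ∧ (C ⊂ᵇ J)) (allSubsets n))

  record Comp (U C : Subset n) : Set where
    field
      inB-comp : inB H C ≡ true
      comp-⊆ : C ⊆ U
      comp-max : ∀ J → inB H J ≡ true → J ⊆ U → C ⊆ J → J ⊆ C
  open Comp

  isComp⇒Comp : ∀ U C → isComp U C ≡ true → Comp U C
  isComp⇒Comp U C e with ∧-true⁻ {inB H C} e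
  ... | b , e′ with ∧-true⁻ {C ⊆ᵇ U} e′
  ...   | s , m = record { inB-comp = b ; comp-⊆ = ⊆ᵇ-true⁻ C U s ; comp-max = mx }
    where
    mx : ∀ J → inB H J ≡ true → J ⊆ U → C ⊆ J → J ⊆ C
    mx J bJ JU CJ with J ⊆? C
    ... | yes f = f
    ... | no nf = contradiction (any-true {p = λ J → inB H J ∧ (J ⊆ᵇ U) ∧ (C ⊂ᵇ J)} (∈-allSubsets J)
      (∧-true bJ (∧-true (⊆ᵇ-true J U JU) (⊂ᵇ-true C J (CJ , nf))))) (not-true⁻ m)

  Comp⇒isComp : ∀ U C → Comp U C → isComp U C ≡ true
  Comp⇒isComp U C c = ∧-true (inB-comp c) (∧-true (⊆ᵇ-true C U (comp-⊆ c)) (not-true none))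
    where
    none : any (λ J → inB H J ∧ (J ⊆ᵇ U) ∧ (C ⊂ᵇ J)) (allSubsets n) ≢ true
    none e with any-true⁻ {xs = allSubsets n} e
    ... | J , _ , e₁ with ∧-true⁻ {inB H J} e₁
    ...   | bJ , e₂ with ∧-true⁻ {J ⊆ᵇ U} e₂
    ...     | JU , CJ with ⊂ᵇ-true⁻ C J CJ
    ...       | C⊆J , J⊈C = J⊈C (comp-max c J bJ (⊆ᵇ-true⁻ J U JU) C⊆J)

  -- The union of two intersecting members of the building set is again a member, so maximality of
  -- `C` swallows `I`.
  comp-absorbs : ∀ U C I → Comp U C → inB H I ≡ true → I ⊆ U → ∀ i → i ∈ I → i ∈ C → I ⊆ C
  comp-absorbs U C I c bI IU i iI iC j jI = comp-max c (I ∪ C) (inB-∪ H I C bI (inB-comp c) i iI iC)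
    (λ k e → case∪ k (∪-case I C k e)) (∪-inʳ I C) j (∪-inˡ I C j jI)
    where
    case∪ : ∀ k → k ∈ I ⊎ k ∈ C → k ∈ U
    case∪ k (inj₁ e) = IU k e
    case∪ k (inj₂ e) = comp-⊆ c k e

  comp-of : ∀ U u → u ∈ U → ∃ λ C → Comp U C × u ∈ C
  comp-of U u uU with argmax ∣_∣ (λ J → mem u J ∧ inB H J ∧ (J ⊆ᵇ U)) (allSubsets n)
  ... | inj₂ none = contradiction
    (∧-true (∈-singleton u) (∧-true (inB-singleton H u) (⊆ᵇ-true (singleton u) U λ i e → subst (_∈ U) (sym (∈-singleton⁻ i u e)) uU)))
    (none (singleton u) (∈-allSubsets _))
  ... | inj₁ (C , _ , p , max) with ∧-true⁻ {mem u C} p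
  ...   | uC , p′ with ∧-true⁻ {inB H C} p′
  ...     | bC , CU = C , record { inB-comp = bC ; comp-⊆ = ⊆ᵇ-true⁻ C U CU ; comp-max = mx } , uC
    where
    mx : ∀ J → inB H J ≡ true → J ⊆ U → C ⊆ J → J ⊆ C
    mx J bJ JU CJ with J ⊆? C
    ... | yes f = f
    ... | no nf = contradiction (max J (∈-allSubsets J) (∧-true (CJ u uC) (∧-true bJ (⊆ᵇ-true J U JU))))
      (<⇒≱ (⊊⇒∣∣< C J (CJ , nf)))

  -- Nested collections inside a vertex set

  nestedInᵇ : Subset n → List (Subset n) → Bool
  nestedInᵇ U N = nestedᵇ N ∧ all (_⊆ᵇ U) N

  nestedInᵇ⁻ : ∀ U N → Unique N → nestedInᵇ U N ≡ true → Nested N × (∀ I → I ∈ˡ N → I ⊆ U)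
  nestedInᵇ⁻ U N u e with ∧-true⁻ {nestedᵇ N} e
  ... | a , b = nestedᵇ⇒Nested N u a , λ I i → ⊆ᵇ-true⁻ I U (all-true⁻ {p = _⊆ᵇ U} b i)

  nestedInᵇ⁺ : ∀ U N → Nested N → (∀ I → I ∈ˡ N → I ⊆ U) → nestedInᵇ U N ≡ true
  nestedInᵇ⁺ U N a b = ∧-true (Nested⇒nestedᵇ N a) (all-true {xs = N} {p = _⊆ᵇ U} λ {I} i → ⊆ᵇ-true I U (b I i))

  -- A component contains or misses every connected subset of `U`, so laminarity with it is
  -- automatic. It never takes part in a forbidden cover either: the covered `K` would be a
  -- connected subset of `U` properly containing it.
  nestedIn-drop-comps : ∀ U N → Unique N → nestedInᵇ U N ≡ nestedInᵇ U (filterᵇ (not ∘ isComp U) N)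
  nestedIn-drop-comps U N u = true-ext to from
    where
    q′ = not ∘ isComp U
    N₀ = filterᵇ q′ N
    N₀⊆ : ∀ I → I ∈ˡ N₀ → I ∈ˡ N
    N₀⊆ I i = proj₁ (∈-filterᵇ⁻ q′ N i)
    to : nestedInᵇ U N ≡ true → nestedInᵇ U N₀ ≡ true
    to e with nestedInᵇ⁻ U N u e
    ... | nest , sub = nestedInᵇ⁺ U N₀ (record
      { tubes = λ I i → tubes nest I (N₀⊆ I i)
      ; laminar = λ I J i j → laminar nest I J (N₀⊆ I i) (N₀⊆ J j)
      ; uncovered = λ K b cover → uncovered nest K b λ i e → let (I , I∈ , r) = cover i e in I , N₀⊆ I I∈ , r })
      λ I i → sub I (N₀⊆ I i)
    from : nestedInᵇ U N₀ ≡ true → nestedInᵇ U N ≡ true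
    from e with nestedInᵇ⁻ U N₀ (filterᵇ-unique q′ u) e
    ... | nest , sub = nestedInᵇ⁺ U N (record { tubes = tb ; laminar = lam ; uncovered = unc }) sb
      where
      split : ∀ I → I ∈ˡ N → I ∈ˡ N₀ ⊎ Comp U I
      split I i with true? (isComp U I)
      ... | yes c = inj₂ (isComp⇒Comp U I c)
      ... | no nc = inj₁ (∈-filterᵇ q′ i (not-true nc))
      tb : ∀ I → I ∈ˡ N → inB H I ≡ true
      tb I i with split I i
      ... | inj₁ i₀ = tubes nest I i₀
      ... | inj₂ c = inB-comp c
      sb : ∀ I → I ∈ˡ N → I ⊆ U
      sb I i with split I i
      ... | inj₁ i₀ = sub I i₀
      ... | inj₂ c = comp-⊆ c
      meet : ∀ I C → Comp U C → inB H I ≡ true → I ⊆ U → I ⊆ C ⊎ Disjoint I C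
      meet I C c bI IU with true? (disjointᵇ I C)
      ... | yes d = inj₂ (disjointᵇ-true⁻ I C d)
      ... | no nd with I ⊆? C
      ...   | yes f = inj₁ f
      ...   | no nf = contradiction (disjointᵇ-true I C λ i a b → nf (comp-absorbs U C I c bI IU i a b)) nd
      lam : ∀ I J → I ∈ˡ N → J ∈ˡ N → I ⊆ J ⊎ J ⊆ I ⊎ Disjoint I J
      lam I J i j with split I i | split J j
      ... | inj₁ i₀ | inj₁ j₀ = laminar nest I J i₀ j₀
      ... | _ | inj₂ c with meet I J c (tb I i) (sb I i)
      ...   | inj₁ f = inj₁ f
      ...   | inj₂ d = inj₂ (inj₂ d)
      lam I J i j | inj₂ c | inj₁ _ with meet J I c (tb J j) (sb J j)
      ...   | inj₁ f = inj₂ (inj₁ f)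
      ...   | inj₂ d = inj₂ (inj₂ λ k a b → d k b a)
      unc : ∀ K → inB H K ≡ true → ¬ (∀ i → i ∈ K → ∃ λ I → I ∈ˡ N × i ∈ I × I ⊊ K)
      unc K b cover = uncovered nest K b cover₀
        where
        KU : K ⊆ U
        KU i iK = let (I , I∈ , i∈I , _) = cover i iK in sb I I∈ i i∈I
        cover₀ : ∀ i → i ∈ K → ∃ λ I → I ∈ˡ N₀ × i ∈ I × I ⊊ K
        cover₀ i iK with cover i iK
        ... | I , I∈ , i∈I , IK with split I I∈
        ...   | inj₁ i₀ = I , i₀ , i∈I , IK
        ...   | inj₂ c = contradiction (comp-max c K b KU (proj₁ IK)) (proj₂ IK)

  -- If the union is `U` and a component `C` is not a member, then the members meeting `C` lie
  -- inside it by `comp-absorbs`, properly, and cover it, against `uncovered`. Conversely the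
  -- components of `U` already cover `U`. The equality of counts says that all components are
  -- members.
  nested-union : ∀ U N → N ∈ˡ sublists (allSubsets n) →
    (nestedᵇ N ∧ (unionAll N ≐ᵇ U)) ≡ (countᵇ (isComp U) N ≡ᵇ countᵇ (isComp U) (allSubsets n)) ∧ nestedInᵇ U N
  nested-union U N s = true-ext to from
    where
    u = sublists-unique (allSubsets-unique n) s
    to : (nestedᵇ N ∧ (unionAll N ≐ᵇ U)) ≡ true →
         (countᵇ (isComp U) N ≡ᵇ countᵇ (isComp U) (allSubsets n)) ∧ nestedInᵇ U N ≡ true
    to e with ∧-true⁻ {nestedᵇ N} e
    ... | a , b with refl ← ≐ᵇ⇒≡ (unionAll N) U b = ∧-true
      (Equivalence.to T-≡ (≡⇒≡ᵇ _ _ (full-countᵇ (isComp U) (allSubsets-unique n) s λ {C} _ → has C)))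
      (nestedInᵇ⁺ U N nest sub)
      where
      nest = nestedᵇ⇒Nested N u a
      sub : ∀ I → I ∈ˡ N → I ⊆ U
      sub I i k e = ∈-unionAll i e
      has : ∀ C → isComp U C ≡ true → C ∈ˡ N
      has C e with C ∈ˡ? N
      ... | yes i = i
      ... | no C∉N = ⊥-elim (uncovered nest C (inB-comp c) cover)
        where
        c = isComp⇒Comp U C e
        cover : ∀ i → i ∈ C → ∃ λ I → I ∈ˡ N × i ∈ I × I ⊊ C
        cover i iC with ∈-unionAll⁻ N (comp-⊆ c i iC)
        ... | I , I∈ , i∈I = I , I∈ , i∈I , IC , λ f → C∉N (subst (_∈ˡ N) (⊆-antisym I C IC f) I∈)
          where IC = comp-absorbs U C I c (tubes nest I I∈) (sub I I∈) i i∈I iC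
    from : (countᵇ (isComp U) N ≡ᵇ countᵇ (isComp U) (allSubsets n)) ∧ nestedInᵇ U N ≡ true →
           (nestedᵇ N ∧ (unionAll N ≐ᵇ U)) ≡ true
    from e with ∧-true⁻ {countᵇ (isComp U) N ≡ᵇ countᵇ (isComp U) (allSubsets n)} e
    ... | a , b with nestedInᵇ⁻ U N u b
    ...   | nest , sub = ∧-true (Nested⇒nestedᵇ N nest) (∧-true
      (⊆ᵇ-true (unionAll N) U λ i e → let (I , I∈ , i∈I) = ∈-unionAll⁻ N e in sub I I∈ i i∈I)
      (⊆ᵇ-true U (unionAll N) λ i e → let (C , c , i∈C) = comp-of U i e in ∈-unionAll (has C (Comp⇒isComp U C c)) i∈C))
      where
      has : ∀ C → isComp U C ≡ true → C ∈ˡ N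
      has C = countᵇ-full (isComp U) s (≡ᵇ⇒≡ _ _ (Equivalence.from T-≡ a)) (∈-allSubsets C)

-- Generating functions

length≡0⇒∉ : {A : Set} {x : A} {xs : List A} → length xs ≡ 0 → ¬ x ∈ˡ xs
length≡0⇒∉ {xs = []} _ ()

unionAll-⊆ᵇ : (U : Subset n) (N : List (Subset n)) → (unionAll N ⊆ᵇ U) ≡ all (_⊆ᵇ U) N
unionAll-⊆ᵇ U N = true-ext
  (λ e → all-true {xs = N} {p = _⊆ᵇ U} λ {I} i → ⊆ᵇ-true I U λ k kI → ⊆ᵇ-true⁻ (unionAll N) U e k (∈-unionAll i kI))
  (λ e → ⊆ᵇ-true (unionAll N) U λ k kN → let (I , i , kI) = ∈-unionAll⁻ N kN in ⊆ᵇ-true⁻ I U (all-true⁻ {p = _⊆ᵇ U} e i) k kI)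

complement : Subset n → Subset n
complement = Vec.map not

-- The formal symbols attached to a fixed `N` form an arbitrary subset of the complement of its
-- union. This exhibits them as an interval, to be summed by `∑-below`.
all-disjoint≡ : (X : Subset n) (N : List (Subset n)) → all (disjointᵇ X) N ≡ (X ⊆ᵇ complement (unionAll N))
all-disjoint≡ X N = true-ext
  (λ e → ⊆ᵇ-true X (complement (unionAll N)) λ i iX → trans (lookup-map i not (unionAll N)) (not-true λ iN →
    let (I , I∈ , iI) = ∈-unionAll⁻ N iN in disjointᵇ-true⁻ X I (all-true⁻ {p = disjointᵇ X} e I∈) i iX iI))
  (λ e → all-true {xs = N} {p = disjointᵇ X} λ {I} I∈ → disjointᵇ-true X I λ i iX iI →
    not-true⁻ (trans (sym (lookup-map i not (unionAll N))) (⊆ᵇ-true⁻ X (complement (unionAll N)) e i iX)) (∈-unionAll I∈ iI))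

codim-∅ : (X : Subset n) → codim X ∅ ≡ ∣ X ∣
codim-∅ [] = refl
codim-∅ (true ∷ X) = cong suc (codim-∅ X)
codim-∅ (false ∷ X) = codim-∅ X

codim-complement : (X : Subset n) → codim (complement X) ∅ ≡ codim full X
codim-complement [] = refl
codim-complement (true ∷ X) = codim-complement X
codim-complement (false ∷ X) = cong suc (codim-complement X)

∑-below : ∀ t (Q : Subset n) → ∑ (allSubsets n) (λ X → ⟦ X ⊆ᵇ Q ⟧ * t ^ ∣ X ∣) ≡ (1 + t) ^ codim Q ∅
∑-below {n} t Q = trans (∑-ext (allSubsets n) λ X → sym (trans (cong (λ b → ⟦ b ⟧ * (⟦ X ⊆ᵇ Q ⟧ * (t ^ codim X ∅ * 1 ^ codim Q X))) (⊥⊆ X))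
    (trans (+-identityʳ _) (cong (⟦ X ⊆ᵇ Q ⟧ *_) (trans (cong₂ _*_ (cong (t ^_) (codim-∅ X)) (^-zeroˡ (codim Q X))) (*-identityʳ _))))))
  (trans (interval-binomial t 1 ∅ Q) (trans (cong (λ b → ⟦ b ⟧ * (t + 1) ^ codim Q ∅) (⊥⊆ Q))
    (trans (+-identityʳ _) (cong (_^ codim Q ∅) (+-comm t 1)))))
  where
  ⊥⊆ : ∀ X → (∅ ⊆ᵇ X) ≡ true
  ⊥⊆ X = ⊆ᵇ-true ∅ X λ i e → contradiction e (∉∅ i)

module _ {n : ℕ} (H : Graph n) where

  comps : Subset n → ℕ
  comps U = countᵇ (isComp H U) (allSubsets n)

  comps≡0⇒∅ : ∀ U → comps U ≡ 0 → U ≡ ∅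
  comps≡0⇒∅ U e = ⊆-antisym U ∅ (λ i iU → ⊥-elim (absurd i iU)) (λ i e → contradiction e (∉∅ i))
    where
    absurd : ∀ i → ¬ i ∈ U
    absurd i iU with comp-of H U i iU
    ... | C , c , _ = length≡0⇒∉ e (∈-filterᵇ (isComp H U) (∈-allSubsets C) (Comp⇒isComp H U C c))

  comps-∅ : comps ∅ ≡ 0
  comps-∅ with filterᵇ (isComp H ∅) (allSubsets n) in eq
  ... | [] = refl
  ... | C ∷ _ = ⊥-elim (∉∅ i (Comp.comp-⊆ c i i∈C))
    where
    c = isComp⇒Comp H ∅ C (proj₂ (∈-filterᵇ⁻ (isComp H ∅) (allSubsets n) (subst (C ∈ˡ_) (sym eq) (here refl))))
    i = proj₁ (inB-nonempty H C (Comp.inB-comp c))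
    i∈C = proj₂ (inB-nonempty H C (Comp.inB-comp c))

  isMax≡isComp : ∀ I → isMax H I ≡ isComp H full I
  isMax≡isComp I = cong (inB H I ∧_) (sym (trans
    (cong (_∧ not (any (λ J → inB H J ∧ (J ⊆ᵇ full) ∧ (I ⊂ᵇ J)) (allSubsets n))) (⊆ᵇ-true I full λ i _ → ∈full i))
    (cong not (any-cong (λ J → cong (λ b → inB H J ∧ b ∧ (I ⊂ᵇ J)) (⊆ᵇ-true J full λ i _ → ∈full i)) (allSubsets n)))))
    where
    any-cong : ∀ {p q : Subset n → Bool} → (∀ J → p J ≡ q J) → ∀ xs → any p xs ≡ any q xs
    any-cong e [] = refl
    any-cong e (x ∷ xs) = cong₂ _∨_ (e x) (any-cong e xs)

  numMax≡comps : numMax H ≡ comps full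
  numMax≡comps = countᵇ-cong isMax≡isComp (allSubsets n)

  -- R_U(t) in the notation of the header.
  genNesto : ℕ → Subset n → ℕ
  genNesto t U = ∑ (sublists (filterᵇ (not ∘ isComp H U) (allSubsets n))) (λ N → ⟦ nestedInᵇ H U N ⟧ * t ^ length N)

  private
    𝓢 = allSubsets n

    unique : ∀ {N} → N ∈ˡ sublists 𝓢 → Unique N
    unique = sublists-unique (allSubsets-unique n)

  ∑-nestedIn : ∀ t U → ∑ (sublists 𝓢) (λ N → ⟦ nestedInᵇ H U N ⟧ * t ^ length N) ≡ (1 + t) ^ comps U * genNesto t U
  ∑-nestedIn t U = trans
    (∑-cong (sublists 𝓢) λ N s → cong (λ b → ⟦ b ⟧ * t ^ length N) (nestedIn-drop-comps H U N (unique s)))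
    (∑-sublists-free t (isComp H U) (λ N → ⟦ nestedInᵇ H U N ⟧) 𝓢)

  ∑-nested-union : ∀ t U →
    ∑ (sublists 𝓢) (λ N → ⟦ nestedᵇ H N ∧ (unionAll N ≐ᵇ U) ⟧ * t ^ length N) ≡ t ^ comps U * genNesto t U
  ∑-nested-union t U = trans
    (∑-cong (sublists 𝓢) λ N s → trans (cong (λ b → ⟦ b ⟧ * t ^ length N)
        (trans (nested-union H U N s) (cong (full? N ∧_) (nestedIn-drop-comps H U N (unique s)))))
      (trans (cong (_* t ^ length N) (⟦∧⟧ (full? N) _)) (*-assoc ⟦ full? N ⟧ _ _)))
    (∑-sublists-full t (isComp H U) (λ N → ⟦ nestedInᵇ H U N ⟧) 𝓢)
    where
    full? : List (Subset n) → Bool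
    full? N = countᵇ (isComp H U) N ≡ᵇ countᵇ (isComp H U) 𝓢

  -- Nested collections are sorted by their union. The indicator of `U′ ⊆ U` as weight `f` yields
  -- the recursion, and a power of `1 + t` yields the extended collections.
  ∑-by-union : ∀ t (f : Subset n → ℕ) →
    ∑ 𝓢 (λ U → f U * (t ^ comps U * genNesto t U))
    ≡ ∑ (sublists 𝓢) (λ N → ⟦ nestedᵇ H N ⟧ * (t ^ length N * f (unionAll N)))
  ∑-by-union t f = begin
    ∑ 𝓢 (λ U → f U * (t ^ comps U * genNesto t U))
      ≡⟨ ∑-ext 𝓢 (λ U → cong (f U *_) (sym (∑-nested-union t U))) ⟩
    ∑ 𝓢 (λ U → f U * ∑ (sublists 𝓢) (λ N → ⟦ nestedᵇ H N ∧ (unionAll N ≐ᵇ U) ⟧ * t ^ length N))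
      ≡⟨ ∑-ext 𝓢 (λ U → trans (sym (∑-*ˡ (f U) _ (sublists 𝓢))) (∑-ext (sublists 𝓢) (shuffle U))) ⟩
    ∑ 𝓢 (λ U → ∑ (sublists 𝓢) (λ N → w N * (⟦ unionAll N ≐ᵇ U ⟧ * f U)))
      ≡⟨ ∑-swap (λ U N → w N * (⟦ unionAll N ≐ᵇ U ⟧ * f U)) 𝓢 (sublists 𝓢) ⟩
    ∑ (sublists 𝓢) (λ N → ∑ 𝓢 (λ U → w N * (⟦ unionAll N ≐ᵇ U ⟧ * f U)))
      ≡⟨ ∑-ext (sublists 𝓢) (λ N → trans (∑-*ˡ (w N) _ 𝓢)
           (trans (cong (w N *_) (∑-delta-subset f (unionAll N))) (*-assoc ⟦ nestedᵇ H N ⟧ _ _))) ⟩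
    ∑ (sublists 𝓢) (λ N → ⟦ nestedᵇ H N ⟧ * (t ^ length N * f (unionAll N))) ∎
    where
    open ≡-Reasoning
    w : List (Subset n) → ℕ
    w N = ⟦ nestedᵇ H N ⟧ * t ^ length N
    shuffle : ∀ U N → f U * (⟦ nestedᵇ H N ∧ (unionAll N ≐ᵇ U) ⟧ * t ^ length N) ≡ w N * (⟦ unionAll N ≐ᵇ U ⟧ * f U)
    shuffle U N = trans (cong (λ z → f U * (z * t ^ length N)) (⟦∧⟧ (nestedᵇ H N) (unionAll N ≐ᵇ U)))
      (solve 4 (λ f a b c → f :* ((a :* b) :* c) := (a :* c) :* (b :* f)) refl (f U) ⟦ nestedᵇ H N ⟧ ⟦ unionAll N ≐ᵇ U ⟧ (t ^ length N))

  -- Both sides enumerate all nested collections inside `U`: the left by their union, the right by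
  -- their part without the components of `U`, which may be added freely.
  genNesto-recursive : ∀ t → Recursive t comps (genNesto t)
  genNesto-recursive t U = trans (∑-by-union t (λ U′ → ⟦ U′ ⊆ᵇ U ⟧)) (trans
    (∑-ext (sublists 𝓢) λ N → trans (cong (λ b → ⟦ nestedᵇ H N ⟧ * (t ^ length N * ⟦ b ⟧)) (unionAll-⊆ᵇ U N))
      (trans (solve 3 (λ a b c → a :* (b :* c) := (a :* c) :* b) refl ⟦ nestedᵇ H N ⟧ (t ^ length N) ⟦ all (_⊆ᵇ U) N ⟧)
        (cong (_* t ^ length N) (sym (⟦∧⟧ (nestedᵇ H N) (all (_⊆ᵇ U) N))))))
    (∑-nestedIn t U))

  genNesto-∅ : ∀ t → genNesto t ∅ ≡ 1
  -- The factor inserted here is 1. It lifts the restriction to non-components, so that the sum runs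
  -- over all sublists.
  genNesto-∅ t = trans (sym (+-identityʳ _)) (trans (cong (λ k → (1 + t) ^ k * genNesto t ∅) (sym comps-∅))
    (trans (sym (∑-nestedIn t ∅)) (only-[] 𝓢)))
    where
    only-[] : ∀ xs → ∑ (sublists xs) (λ N → ⟦ nestedInᵇ H ∅ N ⟧ * t ^ length N) ≡ 1
    only-[] [] = refl
    only-[] (x ∷ xs) = trans (∑-sublists-∷ _ x xs) (cong₂ _+_ (only-[] xs)
      (trans (∑-ext (sublists xs) λ N → cong (λ b → ⟦ b ⟧ * t ^ suc (length N)) (¬-not (bad N))) (∑-zero (sublists xs))))
      where
      bad : ∀ N → nestedInᵇ H ∅ (x ∷ N) ≢ true
      bad N e with ∧-true⁻ {nestedᵇ H (x ∷ N)} e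
      ... | a , b with inB-nonempty H x (all-true⁻ {xs = x ∷ N} {p = inB H} (proj₁ (∧-true⁻ {all (inB H) (x ∷ N)} a)) (here refl))
      ...   | i , i∈x = ∉∅ i (⊆ᵇ-true⁻ x ∅ (all-true⁻ {xs = x ∷ N} {p = _⊆ᵇ ∅} b (here refl)) i i∈x)

  isNested≡ : ∀ N → isNested H N ≡ all (not ∘ isComp H full) N ∧ nestedInᵇ H full N
  isNested≡ N = true-ext to from
    where
    to : isNested H N ≡ true → all (not ∘ isComp H full) N ∧ nestedInᵇ H full N ≡ true
    to e with ∧-true⁻ {all (λ I → inB H I ∧ not (isMax H I)) N} e
    ... | a , b = ∧-true
      (all-true {xs = N} λ {I} i → trans (cong not (sym (isMax≡isComp I))) (proj₂ (∧-true⁻ {inB H I} (all-true⁻ {p = λ I → inB H I ∧ not (isMax H I)} a i))))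
      (∧-true (∧-true (all-true {xs = N} λ {I} i → proj₁ (∧-true⁻ {inB H I} (all-true⁻ {p = λ I → inB H I ∧ not (isMax H I)} a i))) b)
        (all-true {xs = N} {p = _⊆ᵇ full} λ {I} _ → ⊆ᵇ-true I full λ i _ → ∈full i))
    from : all (not ∘ isComp H full) N ∧ nestedInᵇ H full N ≡ true → isNested H N ≡ true
    from e with ∧-true⁻ {all (not ∘ isComp H full) N} e
    ... | a , b with ∧-true⁻ {all (inB H) N} (proj₁ (∧-true⁻ {nestedᵇ H N} b))
    ...   | c , d = ∧-true (all-true {xs = N} λ {I} i →
      ∧-true (all-true⁻ {p = inB H} c i) (trans (cong not (isMax≡isComp I)) (all-true⁻ {p = not ∘ isComp H full} a i))) d

  ∑-isNested : ∀ t → ∑ (sublists 𝓢) (λ N → ⟦ isNested H N ⟧ * t ^ length N) ≡ genNesto t full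
  ∑-isNested t = trans (∑-ext (sublists 𝓢) λ N → trans (cong (λ b → ⟦ b ⟧ * t ^ length N) (isNested≡ N))
      (trans (cong (_* t ^ length N) (⟦∧⟧ (all (not ∘ isComp H full) N) _)) (*-assoc ⟦ all (not ∘ isComp H full) N ⟧ _ _)))
    (∑-sublists-all (not ∘ isComp H full) (λ N → ⟦ nestedInᵇ H full N ⟧ * t ^ length N) 𝓢)

  extPairs : List (List (Subset n) × Subset n)
  extPairs = concatMap (λ N → map (λ X → (N , X)) 𝓢) (sublists 𝓢)

  extSize : List (Subset n) × Subset n → ℕ
  extSize p = length (proj₁ p) + subsetSize (proj₂ p)

  ∑-isExtNested : ∀ t → ∑ extPairs (λ p → ⟦ isExtNested H (proj₁ p) (proj₂ p) ⟧ * t ^ extSize p)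
                      ≡ ∑ 𝓢 (λ M → (1 + t) ^ codim full M * (t ^ comps M * genNesto t M))
  ∑-isExtNested t = trans (∑-concatMap _ _ (sublists 𝓢)) (trans
    (∑-ext (sublists 𝓢) λ N → trans (∑-map _ (λ X → (N , X)) 𝓢) (trans (∑-ext 𝓢 (factor N))
      (trans (∑-*ˡ (⟦ nestedᵇ H N ⟧ * t ^ length N) _ 𝓢) (trans (*-assoc ⟦ nestedᵇ H N ⟧ _ _)
        (cong (λ z → ⟦ nestedᵇ H N ⟧ * (t ^ length N * z)) (trans (∑-below t (complement (unionAll N)))
          (cong ((1 + t) ^_) (codim-complement (unionAll N)))))))))
    (sym (∑-by-union t (λ M → (1 + t) ^ codim full M))))
    where
    regroup : ∀ a b c d → a ∧ b ∧ c ∧ d ≡ (a ∧ b ∧ c) ∧ d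
    regroup true true true d = refl
    regroup true true false d = refl
    regroup true false c d = refl
    regroup false b c d = refl
    factor : ∀ N X → ⟦ isExtNested H N X ⟧ * t ^ (length N + subsetSize X)
                   ≡ (⟦ nestedᵇ H N ⟧ * t ^ length N) * (⟦ X ⊆ᵇ complement (unionAll N) ⟧ * t ^ ∣ X ∣)
    factor N X = trans (cong₂ (λ b k → ⟦ b ⟧ * t ^ (length N + k))
        (trans (regroup (all (inB H) N) (pairwiseOK N) (unionOK H N) _) (cong (nestedᵇ H N ∧_) (all-disjoint≡ X N)))
        (subsetSize≡∣∣ X))
      (trans (cong₂ _*_ (⟦∧⟧ (nestedᵇ H N) (X ⊆ᵇ complement (unionAll N))) (^-distribˡ-+-* t (length N) ∣ X ∣))
        (solve 4 (λ a b c d → (a :* b) :* (c :* d) := (a :* c) :* (b :* d)) refl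
          ⟦ nestedᵇ H N ⟧ ⟦ X ⊆ᵇ complement (unionAll N) ⟧ (t ^ length N) (t ^ ∣ X ∣)))

-- Counting components

map-unique : (f : A → C) {xs : List A} → Unique xs →
             (∀ x y → x ∈ˡ xs → y ∈ˡ xs → f x ≡ f y → x ≡ y) → Unique (map f xs)
map-unique f [] inj = []
map-unique f {x ∷ xs} (x∉ ∷ u) inj = All.tabulate fresh ∷ map-unique f u λ y z i j → inj y z (there i) (there j)
  where
  fresh : ∀ {z} → z ∈ˡ map f xs → f x ≢ z
  fresh i e with ∈-map⁻ f i
  ... | y , j , refl = All.lookup x∉ j (inj x y (here refl) (there j) e)

-- The common form of the two component counts: labels that are constant along edges, and shared
-- only by connected vertices, are in bijection with the components. In both uses the label is the
-- root reached by climbing a rooted forest.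
comps-by-label : ∀ {p} (H : Graph n) (U : Subset n) (lab : Fin n → Fin p) (R : Subset p) →
  (∀ u → u ∈ U → lab u ∈ R) →
  (∀ r → r ∈ R → ∃ λ u → u ∈ U × lab u ≡ r) →
  (∀ u v → u ∈ U → v ∈ U → H u v ≡ true → lab u ≡ lab v) →
  (∀ u v → u ∈ U → v ∈ U → lab u ≡ lab v → Reach H U u v) →
  comps H U ≡ ∣ R ∣
comps-by-label {n} {p} H U lab R lab∈R onto adj conn = trans
  (unique-length-≡ (filterᵇ-unique (isComp H U) (allSubsets-unique n))
    (map-unique cls (filterᵇ-unique (λ r → mem r R) (Uniq.allFin⁺ p)) cls-inj)
    (λ {C} i → comp⇒cls C (isComp⇒Comp H U C (proj₂ (∈-filterᵇ⁻ (isComp H U) (allSubsets n) i))))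
    cls⇒comp)
  (trans (length-map cls roots) (subsetSize≡∣∣ R))
  where
  inCls : Fin p → Fin n → Bool
  inCls r u = mem u U ∧ eqFin (lab u) r

  cls : Fin p → Subset n
  cls r = tabulate (inCls r)

  roots : List (Fin p)
  roots = filterᵇ (λ r → mem r R) (allFin p)

  ∈cls : ∀ u → u ∈ U → ∀ r → lab u ≡ r → u ∈ cls r
  ∈cls u uU r refl = ∈-tabulate (inCls r) u (∧-true uU (eqFin-refl (lab u)))

  ∈cls⁻ : ∀ u r → u ∈ cls r → u ∈ U × lab u ≡ r
  ∈cls⁻ u r e with ∧-true⁻ {mem u U} (∈-tabulate⁻ (inCls r) u e)
  ... | a , b = a , eqFin⇒≡ b

  -- A walk inside `U` never leaves the label class of its start, so connection in `U` becomes
  -- connection within the class.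
  walk : ∀ u v → u ∈ U → Reach H U u v → lab v ≡ lab u × Reach H (cls (lab u)) u v
  walk u .u uU done = refl , done
  walk u w uU (step▷ {v} r h wU) with walk u v uU r
  ... | e , r′ = e′ , step▷ r′ h (∈cls w wU (lab u) e′)
    where e′ = trans (sym (adj v w (reach-∈ uU r) wU h)) e

  cls-comp : ∀ u → u ∈ U → Comp H U (cls (lab u))
  cls-comp u uU = record
    { inB-comp = inB-intro H (cls (lab u)) u (∈cls u uU _ refl) pairs
    ; comp-⊆ = λ v e → proj₁ (∈cls⁻ v (lab u) e)
    ; comp-max = λ J bJ JU cJ j jJ → ∈cls j (JU j jJ) (lab u)
        (proj₁ (walk u j uU (reach-mono J U JU (inB-reach H J bJ u j (cJ u (∈cls u uU _ refl)) jJ)))) }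
    where
    pairs : ∀ v w → v ∈ cls (lab u) → w ∈ cls (lab u) → Reach H (cls (lab u)) v w
    pairs v w e f with ∈cls⁻ v (lab u) e | ∈cls⁻ w (lab u) f
    ... | vU , ev | wU , ew = subst (λ r → Reach H (cls r) v w) ev
      (proj₂ (walk v w vU (conn v w vU wU (trans ev (sym ew)))))

  cls-inj : ∀ r s → r ∈ˡ roots → s ∈ˡ roots → cls r ≡ cls s → r ≡ s
  cls-inj r s i j e with onto r (proj₂ (∈-filterᵇ⁻ (λ r → mem r R) (allFin p) i))
  ... | u , uU , er = trans (sym er) (proj₂ (∈cls⁻ u s (subst (u ∈_) e (∈cls u uU r er))))

  cls⇒comp : ∀ {C} → C ∈ˡ map cls roots → C ∈ˡ filterᵇ (isComp H U) (allSubsets n)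
  cls⇒comp i with ∈-map⁻ cls i
  ... | r , j , refl with onto r (proj₂ (∈-filterᵇ⁻ (λ r → mem r R) (allFin p) j))
  ...   | u , uU , refl = ∈-filterᵇ (isComp H U) (∈-allSubsets (cls r)) (Comp⇒isComp H U (cls r) (cls-comp u uU))

  comp⇒cls : ∀ C → Comp H U C → C ∈ˡ map cls roots
  comp⇒cls C c with inB-nonempty H C (Comp.inB-comp c)
  ... | u , uC = subst (_∈ˡ map cls roots) (⊆-antisym (cls (lab u)) C
      (comp-absorbs H U C (cls (lab u)) c (Comp.inB-comp c′) (Comp.comp-⊆ c′) u u∈ uC)
      (comp-absorbs H U (cls (lab u)) C c′ (Comp.inB-comp c) (Comp.comp-⊆ c) u uC u∈))
    (∈-map⁺ cls (∈-filterᵇ (λ r → mem r R) (∈-allFin (lab u)) (lab∈R u uU)))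
    where
    uU = Comp.comp-⊆ c u uC
    c′ = cls-comp u uU
    u∈ = ∈cls u uU (lab u) refl

-- Rooted forests

-- Edge e joins child e to parent e; the roots are the vertices that are no edge's child.
record RootedForest (n m : ℕ) : Set where
  field
    child parent : Fin m → Fin n
    child-injective : Injective _≡_ _≡_ child
    height : Fin n → ℕ
    parent-lower : ∀ e → height (parent e) < height (child e)

infixl 6 _∖_

_∖_ : Subset n → Subset n → Subset n
_∖_ = zipWith (λ x y → x ∧ not y)

∈-∖ : (I J : Subset n) → ∀ i → i ∈ I → ¬ i ∈ J → i ∈ I ∖ J
∈-∖ I J i a b = trans (lookup-zipWith _ i I J) (∧-true a (not-true b))

∈-∖⁻ : (I J : Subset n) → ∀ i → i ∈ I ∖ J → i ∈ I × ¬ i ∈ J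
∈-∖⁻ I J i e with ∧-true⁻ {mem i I} (trans (sym (lookup-zipWith _ i I J)) e)
... | a , b = a , not-true⁻ b

codim≡∣∖∣ : (I J : Subset n) → codim J I ≡ ∣ J ∖ I ∣
codim≡∣∖∣ [] [] = refl
codim≡∣∖∣ (x ∷ I) (y ∷ J) with y ∧ not x
... | true = cong suc (codim≡∣∖∣ I J)
... | false = codim≡∣∖∣ I J

module Rooted {n m : ℕ} (F : RootedForest n m) where

  open RootedForest F

  isActive : Subset m → Fin n → Bool
  isActive S v = any (λ e → mem e S ∧ eqFin (child e) v) (allFin m)

  -- The non-roots of the forest with edge set `S`, that is, the vertices with an edge of `S`
  -- leading to their parent.
  active : Subset m → Subset n
  active S = tabulate (isActive S)

  ∈-active : ∀ S e → e ∈ S → child e ∈ active S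
  ∈-active S e eS = ∈-tabulate (isActive S) (child e)
    (any-true {p = λ f → mem f S ∧ eqFin (child f) (child e)} (∈-allFin e) (∧-true eS (eqFin-refl (child e))))

  ∈-active⁻ : ∀ S v → v ∈ active S → ∃ λ e → e ∈ S × child e ≡ v
  ∈-active⁻ S v p with any-true⁻ {xs = allFin m} (∈-tabulate⁻ (isActive S) v p)
  ... | e , _ , q with ∧-true⁻ {mem e S} q
  ...   | eS , ev = e , eS , eqFin⇒≡ ev

  ∣active∣ : ∀ S → ∣ active S ∣ ≡ ∣ S ∣
  ∣active∣ S = trans (sym (subsetSize≡∣∣ (active S))) (trans
    (unique-length-≡ (filterᵇ-unique (λ v → mem v (active S)) (Uniq.allFin⁺ n))
      (Uniq.map⁺ child-injective (filterᵇ-unique (λ e → mem e S) (Uniq.allFin⁺ m))) to from)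
    (trans (length-map child (filterᵇ (λ e → mem e S) (allFin m))) (subsetSize≡∣∣ S)))
    where
    to : ∀ {v} → v ∈ˡ filterᵇ (λ v → mem v (active S)) (allFin n) → v ∈ˡ map child (filterᵇ (λ e → mem e S) (allFin m))
    to {v} i with ∈-active⁻ S v (proj₂ (∈-filterᵇ⁻ (λ v → mem v (active S)) (allFin n) i))
    ... | e , eS , refl = ∈-map⁺ child (∈-filterᵇ (λ e → mem e S) (∈-allFin e) eS)
    from : ∀ {v} → v ∈ˡ map child (filterᵇ (λ e → mem e S) (allFin m)) → v ∈ˡ filterᵇ (λ v → mem v (active S)) (allFin n)
    from i with ∈-map⁻ child i
    ... | e , j , refl = ∈-filterᵇ (λ v → mem v (active S)) (∈-allFin (child e))
      (∈-active S e (proj₂ (∈-filterᵇ⁻ (λ e → mem e S) (allFin m) j)))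

  -- Injectivity of `child` lets each edge account for exactly one non-root, so the number of trees
  -- on `X` is the number of vertices minus the number of edges.
  roots-count : ∀ X S → active S ⊆ X → ∣ X ∖ active S ∣ + ∣ S ∣ ≡ ∣ X ∣
  roots-count X S f = trans (cong₂ _+_ (sym (codim≡∣∖∣ (active S) X)) (sym (∣active∣ S))) (codim+∣∣ (active S) X f)

  data Up (S : Subset m) : Fin n → Fin n → Set where
    stop : ∀ {v} → Up S v v
    go : ∀ {v r} e → e ∈ S → child e ≡ v → Up S (parent e) r → Up S v r

  -- Injectivity of `child` leaves at most one upward edge at each vertex, so climbing is
  -- deterministic and can end only at an inactive vertex.
  up-unique : ∀ {S v r s} → Up S v r → ¬ r ∈ active S → Up S v s → ¬ s ∈ active S → r ≡ s
  up-unique stop _ stop _ = refl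
  up-unique {S} stop nr (go e eS refl _) _ = contradiction (∈-active S e eS) nr
  up-unique {S} (go e eS refl _) _ stop ns = contradiction (∈-active S e eS) ns
  up-unique (go e _ e≡ p) nr (go f _ f≡ q) ns with refl ← child-injective (trans e≡ (sym f≡)) = up-unique p nr q ns

  climb : ∀ S v → Acc _<_ (height v) → ∃ λ r → Up S v r × ¬ r ∈ active S
  climb S v (acc rs) with true? (mem v (active S))
  ... | no nv = v , stop , nv
  ... | yes av with ∈-active⁻ S v av
  ...   | e , eS , refl with climb S (parent e) (rs (parent-lower e))
  ...     | r , up , nr = r , go e eS refl up , nr

  top : Subset m → Fin n → Fin n
  top S v = proj₁ (climb S v (<-wellFounded _))

  top-up : ∀ S v → Up S v (top S v)
  top-up S v = proj₁ (proj₂ (climb S v (<-wellFounded _)))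

  top-inactive : ∀ S v → ¬ top S v ∈ active S
  top-inactive S v = proj₂ (proj₂ (climb S v (<-wellFounded _)))

  top-edge : ∀ S e → e ∈ S → top S (child e) ≡ top S (parent e)
  top-edge S e eS = up-unique (top-up S (child e)) (top-inactive S (child e)) (go e eS refl (top-up S (parent e))) (top-inactive S (parent e))

  top-root : ∀ S r → ¬ r ∈ active S → top S r ≡ r
  top-root S r nr = up-unique (top-up S r) (top-inactive S r) stop nr

  -- Edges inside a vertex set, ends of an edge set, and their component counts

  bothIn : Subset n → Fin m → Bool
  bothIn U e = mem (child e) U ∧ mem (parent e) U

  edgesIn : Subset n → Subset m
  edgesIn U = tabulate (bothIn U)

  ∈-edgesIn⁻ : ∀ U e → e ∈ edgesIn U → child e ∈ U × parent e ∈ U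
  ∈-edgesIn⁻ U e p = ∧-true⁻ {mem (child e) U} (∈-tabulate⁻ (bothIn U) e p)

  ∈-edgesIn : ∀ U e → child e ∈ U → parent e ∈ U → e ∈ edgesIn U
  ∈-edgesIn U e a b = ∈-tabulate (bothIn U) e (∧-true a b)

  isEnd : Subset m → Fin n → Bool
  isEnd M v = any (λ e → mem e M ∧ (eqFin (child e) v ∨ eqFin (parent e) v)) (allFin m)

  ends : Subset m → Subset n
  ends M = tabulate (isEnd M)

  End : Fin n → Fin m → Set
  End v e = child e ≡ v ⊎ parent e ≡ v

  ∈-ends : ∀ M e v → e ∈ M → End v e → v ∈ ends M
  ∈-ends M e v eM end = ∈-tabulate (isEnd M) v
    (any-true {p = λ e → mem e M ∧ (eqFin (child e) v ∨ eqFin (parent e) v)} (∈-allFin e) (∧-true eM (side end)))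
    where
    side : End v e → eqFin (child e) v ∨ eqFin (parent e) v ≡ true
    side (inj₁ refl) = ∨-trueˡ (eqFin-refl v)
    side (inj₂ refl) = ∨-trueʳ {eqFin (child e) v} (eqFin-refl v)

  ∈-ends⁻ : ∀ M v → v ∈ ends M → ∃ λ e → e ∈ M × End v e
  ∈-ends⁻ M v p with any-true⁻ {xs = allFin m} (∈-tabulate⁻ (isEnd M) v p)
  ... | e , _ , q with ∧-true⁻ {mem e M} q
  ...   | eM , side with ∨-true⁻ {eqFin (child e) v} side
  ...     | inj₁ a = e , eM , inj₁ (eqFin⇒≡ a)
  ...     | inj₂ b = e , eM , inj₂ (eqFin⇒≡ b)

  -- This adjunction permits the exchange of the sums over edge sets and vertex sets: an upper bound
  -- on `M` given by `U` becomes a lower bound on `U` given by `M`.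
  galois : ∀ M U → (M ⊆ᵇ edgesIn U) ≡ (ends M ⊆ᵇ U)
  galois M U = true-ext
    (λ e → ⊆ᵇ-true (ends M) U λ v p → let (f , fM , end) = ∈-ends⁻ M v p in
      side f end (∈-edgesIn⁻ U f (⊆ᵇ-true⁻ M (edgesIn U) e f fM)))
    (λ e → ⊆ᵇ-true M (edgesIn U) λ f fM → ∈-edgesIn U f
      (⊆ᵇ-true⁻ (ends M) U e _ (∈-ends M f _ fM (inj₁ refl))) (⊆ᵇ-true⁻ (ends M) U e _ (∈-ends M f _ fM (inj₂ refl))))
    where
    side : ∀ {v} f → End v f → child f ∈ U × parent f ∈ U → v ∈ U
    side f (inj₁ refl) = proj₁
    side f (inj₂ refl) = proj₂

  module _ (G : Graph n) (G-sym : ∀ u v → G u v ≡ G v u)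
           (edge-G : ∀ e → G (child e) (parent e) ≡ true)
           (G-edge : ∀ u v → G u v ≡ true → ∃ λ e → (child e ≡ u × parent e ≡ v) ⊎ (child e ≡ v × parent e ≡ u)) where

    -- Climbing along the edges inside `U` stays in `U`, so each tree has one root in `U`. These
    -- trees are the components, and `roots-count` counts their roots.
    euler-vertices : ∀ U → comps G U + ∣ edgesIn U ∣ ≡ ∣ U ∣
    euler-vertices U = trans (cong (_+ ∣ S ∣) (comps-by-label G U (top S) (U ∖ active S)
        (λ u uU → ∈-∖ U (active S) (top S u) (up-∈ uU (top-up S u)) (top-inactive S u))
        (λ r p → let (rU , nr) = ∈-∖⁻ U (active S) r p in r , rU , top-root S r nr)
        adj conn))
      (roots-count U S λ v p → let (e , eS , ev) = ∈-active⁻ S v p in subst (_∈ U) ev (proj₁ (∈-edgesIn⁻ U e eS)))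
      where
      S = edgesIn U
      up-∈ : ∀ {v r} → v ∈ U → Up S v r → r ∈ U
      up-∈ vU stop = vU
      up-∈ vU (go e eS _ up) = up-∈ (proj₂ (∈-edgesIn⁻ U e eS)) up
      up-reach : ∀ {v r} → Up S v r → Reach G U v r
      up-reach stop = done
      up-reach (go e eS refl up) = reach-trans (step▷ done (edge-G e) (proj₂ (∈-edgesIn⁻ U e eS))) (up-reach up)
      adj : ∀ u v → u ∈ U → v ∈ U → G u v ≡ true → top S u ≡ top S v
      adj u v uU vU h with G-edge u v h
      ... | e , inj₁ (refl , refl) = top-edge S e (∈-edgesIn U e uU vU)
      ... | e , inj₂ (refl , refl) = sym (top-edge S e (∈-edgesIn U e vU uU))
      conn : ∀ u v → u ∈ U → v ∈ U → top S u ≡ top S v → Reach G U u v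
      conn u v uU vU e = reach-trans (up-reach (top-up S u))
        (subst (λ r → Reach G U r v) (sym e) (reach-sym G-sym vU (up-reach (top-up S v))))

  module _ (L : Graph m) (L-sym : ∀ e f → L e f ≡ L f e)
           (L-share : ∀ e f → L e f ≡ true → ∃ λ v → End v e × End v f)
           (share-L : ∀ e f v → e ≢ f → End v e → End v f → L e f ≡ true) where

    -- The components of the line graph on `M` are the trees of the forest with edges `M` on the
    -- vertices `ends M`, each edge being labelled by the root of its tree. No tree is a single
    -- vertex, since every vertex of `ends M` lies on an edge of `M`; hence every root occurs as a
    -- label.
    euler-edges : ∀ M → comps L M + ∣ M ∣ ≡ ∣ ends M ∣
    euler-edges M = trans (cong (_+ ∣ M ∣) (comps-by-label L M (λ e → top M (child e)) (ends M ∖ active M)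
        (λ e eM → ∈-∖ (ends M) (active M) _ (up-∈ (∈-ends M e _ eM (inj₁ refl)) (top-up M (child e))) (top-inactive M (child e)))
        onto adj conn))
      (roots-count (ends M) M λ v p → let (e , eM , ev) = ∈-active⁻ M v p in ∈-ends M e v eM (inj₁ ev))
      where
      up-∈ : ∀ {v r} → v ∈ ends M → Up M v r → r ∈ ends M
      up-∈ vM stop = vM
      up-∈ vM (go e eM _ up) = up-∈ (∈-ends M e _ eM (inj₂ refl)) up
      top-end : ∀ e v → e ∈ M → End v e → top M (child e) ≡ top M v
      top-end e v eM (inj₁ refl) = refl
      top-end e v eM (inj₂ refl) = top-edge M e eM
      onto : ∀ r → r ∈ ends M ∖ active M → ∃ λ e → e ∈ M × top M (child e) ≡ r
      onto r p with ∈-∖⁻ (ends M) (active M) r p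
      ... | rM , nr with ∈-ends⁻ M r rM
      ...   | e , eM , end = e , eM , trans (top-end e r eM end) (top-root M r nr)
      adj : ∀ e f → e ∈ M → f ∈ M → L e f ≡ true → top M (child e) ≡ top M (child f)
      adj e f eM fM h with L-share e f h
      ... | v , ev , fv = trans (top-end e v eM ev) (sym (top-end f v fM fv))
      hop : ∀ e f v → f ∈ M → End v e → End v f → Reach L M e f
      hop e f v fM ev fv with e ≟ f
      ... | yes refl = done
      ... | no ne = step▷ done (share-L e f v ne ev fv) fM
      -- Consecutive edges on an upward path share a vertex. An edge is thereby joined to one ending
      -- at the root, where all such final edges of the tree meet.
      highest : ∀ {v r} e → e ∈ M → parent e ≡ v → Up M v r → ∃ λ f → f ∈ M × parent f ≡ r × Reach L M e f
      highest e eM eq stop = e , eM , eq , done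
      highest e eM eq (go f fM refl up) with highest f fM refl up
      ... | g , gM , eq′ , r = g , gM , eq′ , reach-trans (hop e f (child f) fM (inj₂ eq) (inj₁ refl)) r
      conn : ∀ e f → e ∈ M → f ∈ M → top M (child e) ≡ top M (child f) → Reach L M e f
      conn e f eM fM eq with highest e eM refl (top-up M (parent e)) | highest f fM refl (top-up M (parent f))
      ... | e′ , e′M , pe , re | f′ , f′M , pf , rf = reach-trans re (reach-trans
        (hop e′ f′ (top M (parent f)) f′M
          (inj₂ (trans pe (trans (sym (top-edge M e eM)) (trans eq (top-edge M f fM))))) (inj₂ pf))
        (reach-sym L-sym fM rf))

-- Passing from edges to vertices

∑-product : {A C : Set} (f : C → ℕ) (g : A → ℕ) (xs : List A) (ys : List C) →
            ∑ xs (λ x → ∑ ys (λ y → f y * g x)) ≡ ∑ ys f * ∑ xs g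
∑-product f g xs ys = trans (∑-ext xs λ x → ∑-*ʳ (g x) f ys) (∑-*ˡ (∑ ys f) g xs)

module _ {n m : ℕ} (t : ℕ)
  (c : Subset n → ℕ) (k : Subset m → ℕ) (E : Subset n → Subset m) (V : Subset m → Subset n)
  (galois : ∀ M U → (M ⊆ᵇ E U) ≡ (V M ⊆ᵇ U))
  (euler-c : ∀ U → c U + ∣ E U ∣ ≡ ∣ U ∣) (euler-k : ∀ M → k M + ∣ M ∣ ≡ ∣ V M ∣)
  (g : Subset m → ℕ) (rec : Recursive t k g)
  where

  private
    𝓤 = allSubsets n
    𝓜 = allSubsets m

    B : Subset m → ℕ
    B M = t ^ k M * g M

  -- The quantity D_U, formed from any solution `g` of the recursion on edge sets. Graphs enter
  -- through the adjunction and the two counts alone.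
  fromEdges : Subset n → ℕ
  fromEdges U = ∑ 𝓜 (λ M → ⟦ M ⊆ᵇ E U ⟧ * ((1 + t) ^ codim (E U) M * B M))

  -- After adding the cardinality of `M`, each side becomes the cardinality of `U`, by one of the
  -- two counts.
  exponents : ∀ M U → (M ⊆ᵇ E U) ≡ true → c U + codim (E U) M ≡ k M + codim U (V M)
  exponents M U e = +-cancelʳ-≡ ∣ M ∣ _ _ (begin
    c U + codim (E U) M + ∣ M ∣    ≡⟨ +-assoc (c U) _ _ ⟩
    c U + (codim (E U) M + ∣ M ∣)  ≡⟨ cong (c U +_) (codim+∣∣ M (E U) (⊆ᵇ-true⁻ M (E U) e)) ⟩
    c U + ∣ E U ∣                  ≡⟨ euler-c U ⟩
    ∣ U ∣                          ≡⟨ codim+∣∣ (V M) U (⊆ᵇ-true⁻ (V M) U (trans (sym (galois M U)) e)) ⟨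
    codim U (V M) + ∣ V M ∣        ≡⟨ cong (codim U (V M) +_) (euler-k M) ⟨
    codim U (V M) + (k M + ∣ M ∣)  ≡⟨ solve 3 (λ a b c → a :+ (b :+ c) := b :+ a :+ c) refl (codim U (V M)) (k M) ∣ M ∣ ⟩
    k M + codim U (V M) + ∣ M ∣    ∎)
    where open ≡-Reasoning

  exponents-^ : ∀ s M U → ⟦ M ⊆ᵇ E U ⟧ * (s ^ c U * s ^ codim (E U) M) ≡ ⟦ V M ⊆ᵇ U ⟧ * (s ^ k M * s ^ codim U (V M))
  exponents-^ s M U = trans (⟦⟧-cong-* (M ⊆ᵇ E U) λ e → trans (sym (^-distribˡ-+-* s (c U) _))
      (trans (cong (s ^_) (exponents M U e)) (^-distribˡ-+-* s (k M) _)))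
    (cong (λ b → ⟦ b ⟧ * (s ^ k M * s ^ codim U (V M))) (galois M U))

  fromEdges-recursive : Recursive t c fromEdges
  fromEdges-recursive U = begin
    ∑ 𝓤 (λ U′ → ⟦ U′ ⊆ᵇ U ⟧ * (t ^ c U′ * fromEdges U′))
      ≡⟨ ∑-ext 𝓤 expand ⟩
    ∑ 𝓤 (λ U′ → ∑ 𝓜 (λ W → ∑ 𝓜 (λ M → below M W * between M U′)))
      ≡⟨ ∑-ext 𝓤 (λ U′ → ∑-swap (λ W M → below M W * between M U′) 𝓜 𝓜) ⟩
    ∑ 𝓤 (λ U′ → ∑ 𝓜 (λ M → ∑ 𝓜 (λ W → below M W * between M U′)))
      ≡⟨ ∑-swap (λ U′ M → ∑ 𝓜 (λ W → below M W * between M U′)) 𝓤 𝓜 ⟩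
    ∑ 𝓜 (λ M → ∑ 𝓤 (λ U′ → ∑ 𝓜 (λ W → below M W * between M U′)))
      -- For fixed `M`, the set `W` only has to lie below `M`, and `U′` only between `V M` and `U`;
      -- the double sum splits into a product.
      ≡⟨ ∑-ext 𝓜 (λ M → ∑-product (below M) (between M) 𝓤 𝓜) ⟩
    ∑ 𝓜 (λ M → ∑ 𝓜 (below M) * ∑ 𝓤 (between M))
      ≡⟨ ∑-ext 𝓜 collapse ⟩
    ∑ 𝓜 (λ M → (1 + t) ^ c U * (⟦ M ⊆ᵇ E U ⟧ * ((1 + t) ^ codim (E U) M * B M)))
      ≡⟨ ∑-*ˡ ((1 + t) ^ c U) _ 𝓜 ⟩
    (1 + t) ^ c U * fromEdges U ∎
    where
    open ≡-Reasoning
    below : Subset m → Subset m → ℕ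
    below M W = t ^ k M * (⟦ W ⊆ᵇ M ⟧ * B W)
    -- The power of 1 is carried along to match the summand of `interval-binomial t 1` on the
    -- interval from `V M` to `U`.
    between : Subset m → Subset n → ℕ
    between M U′ = ⟦ V M ⊆ᵇ U′ ⟧ * (⟦ U′ ⊆ᵇ U ⟧ * (t ^ codim U′ (V M) * 1 ^ codim U U′))

    pointwise : ∀ U′ W M →
      ⟦ U′ ⊆ᵇ U ⟧ * t ^ c U′ * ((⟦ W ⊆ᵇ M ⟧ * (⟦ M ⊆ᵇ E U′ ⟧ * (1 ^ codim M W * t ^ codim (E U′) M))) * B W)
      ≡ below M W * between M U′
    pointwise U′ W M = begin
      ⟦ U′ ⊆ᵇ U ⟧ * t ^ c U′ * ((⟦ W ⊆ᵇ M ⟧ * (⟦ M ⊆ᵇ E U′ ⟧ * (1 ^ codim M W * t ^ codim (E U′) M))) * B W)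
        ≡⟨ cong (λ z → ⟦ U′ ⊆ᵇ U ⟧ * t ^ c U′ * ((⟦ W ⊆ᵇ M ⟧ * (⟦ M ⊆ᵇ E U′ ⟧ * (z * t ^ codim (E U′) M))) * B W)) (^-zeroˡ (codim M W)) ⟩
      ⟦ U′ ⊆ᵇ U ⟧ * t ^ c U′ * ((⟦ W ⊆ᵇ M ⟧ * (⟦ M ⊆ᵇ E U′ ⟧ * (1 * t ^ codim (E U′) M))) * B W)
        ≡⟨ solve 6 (λ u p w m q b → u :* p :* ((w :* (m :* (con 1 :* q))) :* b) := (w :* b) :* u :* (m :* (p :* q))) refl
             ⟦ U′ ⊆ᵇ U ⟧ (t ^ c U′) ⟦ W ⊆ᵇ M ⟧ ⟦ M ⊆ᵇ E U′ ⟧ (t ^ codim (E U′) M) (B W) ⟩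
      (⟦ W ⊆ᵇ M ⟧ * B W) * ⟦ U′ ⊆ᵇ U ⟧ * (⟦ M ⊆ᵇ E U′ ⟧ * (t ^ c U′ * t ^ codim (E U′) M))
        -- The passage from edges to vertices: the exponent stops depending on `c U′` and `E U′`,
        -- and the remaining dependence on `U′` is a power of `t` on an interval.
        ≡⟨ cong ((⟦ W ⊆ᵇ M ⟧ * B W) * ⟦ U′ ⊆ᵇ U ⟧ *_) (exponents-^ t M U′) ⟩
      (⟦ W ⊆ᵇ M ⟧ * B W) * ⟦ U′ ⊆ᵇ U ⟧ * (⟦ V M ⊆ᵇ U′ ⟧ * (t ^ k M * t ^ codim U′ (V M)))
        ≡⟨ solve 5 (λ w u v p q → w :* u :* (v :* (p :* q)) := (p :* w) :* (v :* (u :* (q :* con 1)))) refl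
             (⟦ W ⊆ᵇ M ⟧ * B W) ⟦ U′ ⊆ᵇ U ⟧ ⟦ V M ⊆ᵇ U′ ⟧ (t ^ k M) (t ^ codim U′ (V M)) ⟩
      below M W * (⟦ V M ⊆ᵇ U′ ⟧ * (⟦ U′ ⊆ᵇ U ⟧ * (t ^ codim U′ (V M) * 1)))
        ≡⟨ cong (λ z → below M W * (⟦ V M ⊆ᵇ U′ ⟧ * (⟦ U′ ⊆ᵇ U ⟧ * (t ^ codim U′ (V M) * z)))) (sym (^-zeroˡ (codim U U′))) ⟩
      below M W * between M U′ ∎

    expand : ∀ U′ → ⟦ U′ ⊆ᵇ U ⟧ * (t ^ c U′ * fromEdges U′) ≡ ∑ 𝓜 (λ W → ∑ 𝓜 (λ M → below M W * between M U′))
    expand U′ = trans (sym (*-assoc ⟦ U′ ⊆ᵇ U ⟧ (t ^ c U′) (fromEdges U′)))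
      (trans (sym (∑-*ˡ (⟦ U′ ⊆ᵇ U ⟧ * t ^ c U′) _ 𝓜))
        (∑-ext 𝓜 λ W → trans (cong (⟦ U′ ⊆ᵇ U ⟧ * t ^ c U′ *_)
            (trans (sym (*-assoc ⟦ W ⊆ᵇ E U′ ⟧ ((1 + t) ^ codim (E U′) W) (B W)))
              (trans (cong (_* B W) (sym (interval-binomial 1 t W (E U′)))) (sym (∑-*ʳ (B W) _ 𝓜)))))
          (trans (sym (∑-*ˡ (⟦ U′ ⊆ᵇ U ⟧ * t ^ c U′) _ 𝓜)) (∑-ext 𝓜 (pointwise U′ W)))))

    collapse : ∀ M → ∑ 𝓜 (below M) * ∑ 𝓤 (between M)
                   ≡ (1 + t) ^ c U * (⟦ M ⊆ᵇ E U ⟧ * ((1 + t) ^ codim (E U) M * B M))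
    collapse M = begin
      ∑ 𝓜 (below M) * ∑ 𝓤 (between M)
        ≡⟨ cong₂ _*_ (trans (∑-*ˡ (t ^ k M) _ 𝓜) (cong (t ^ k M *_) (rec M)))
             (trans (interval-binomial t 1 (V M) U) (cong (λ z → ⟦ V M ⊆ᵇ U ⟧ * z ^ codim U (V M)) (+-comm t 1))) ⟩
      t ^ k M * ((1 + t) ^ k M * g M) * (⟦ V M ⊆ᵇ U ⟧ * (1 + t) ^ codim U (V M))
        ≡⟨ solve 5 (λ a b c v d → a :* (b :* c) :* (v :* d) := (a :* c) :* (v :* (b :* d))) refl
             (t ^ k M) ((1 + t) ^ k M) (g M) ⟦ V M ⊆ᵇ U ⟧ ((1 + t) ^ codim U (V M)) ⟩
      B M * (⟦ V M ⊆ᵇ U ⟧ * ((1 + t) ^ k M * (1 + t) ^ codim U (V M)))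
        -- The same identity of exponents read backwards, now in base `1 + t` and at `U` itself.
        ≡⟨ cong (B M *_) (sym (exponents-^ (1 + t) M U)) ⟩
      B M * (⟦ M ⊆ᵇ E U ⟧ * ((1 + t) ^ c U * (1 + t) ^ codim (E U) M))
        ≡⟨ solve 4 (λ b m p q → b :* (m :* (p :* q)) := p :* (m :* (q :* b))) refl
             (B M) ⟦ M ⊆ᵇ E U ⟧ ((1 + t) ^ c U) ((1 + t) ^ codim (E U) M) ⟩
      (1 + t) ^ c U * (⟦ M ⊆ᵇ E U ⟧ * ((1 + t) ^ codim (E U) M * B M)) ∎

-- Orienting a forest

-- Pigeonhole gives some repetition. The earliest one is taken because the vertices before it are
-- then distinct, so the stretch from `i` to `k` closes up to a simple cycle.
first-collision : (w : ℕ → Fin n) →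
  ∃ λ i → ∃ λ k → i < k × w i ≡ w k × (∀ a b → a < k → b < k → w a ≡ w b → a ≡ b)
first-collision {n} w with search (suc n)
  where
  InjectiveBelow : ℕ → Set
  InjectiveBelow k = ∀ a b → a < k → b < k → w a ≡ w b → a ≡ b
  search : ∀ j → InjectiveBelow j ⊎ ∃ λ i → ∃ λ k → i < k × w i ≡ w k × InjectiveBelow k
  search zero = inj₁ λ _ _ ()
  search (suc j) with search j
  ... | inj₂ found = inj₂ found
  ... | inj₁ inj with any? (λ (i : Fin j) → w (toℕ i) ≟ w j)
  ...   | yes (i , e) = inj₂ (toℕ i , j , toℕ<n i , e , inj)
  ...   | no fresh = inj₁ extend
    where
    new : ∀ a → a < j → w a ≢ w j
    new a lt e = fresh (fromℕ< lt , trans (cong w (toℕ-fromℕ< lt)) e)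
    extend : InjectiveBelow (suc j)
    extend a b (s≤s a≤j) (s≤s b≤j) e with m≤n⇒m<n∨m≡n a≤j | m≤n⇒m<n∨m≡n b≤j
    ... | inj₁ a<j | inj₁ b<j = inj a b a<j b<j e
    ... | inj₁ a<j | inj₂ refl = contradiction e (new a a<j)
    ... | inj₂ refl | inj₁ b<j = contradiction (sym e) (new b b<j)
    ... | inj₂ refl | inj₂ refl = refl
... | inj₂ found = found
... | inj₁ inj = contradiction (injective⇒≤ {f = w ∘ toℕ} λ {a} {b} e → toℕ-injective (inj _ _ (toℕ<n a) (toℕ<n b) e)) (<⇒≱ (n<1+n n))

lookup-injective : {A : Set} {xs : List A} → Unique xs → ∀ {i j} → List.lookup xs i ≡ List.lookup xs j → i ≡ j
lookup-injective (x∉ ∷ u) {zero} {zero} e = refl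
lookup-injective (x∉ ∷ u) {zero} {suc j} e = contradiction e (All.lookup x∉ (∈-lookup j))
lookup-injective (x∉ ∷ u) {suc i} {zero} e = contradiction (sym e) (All.lookup x∉ (∈-lookup i))
lookup-injective (x∉ ∷ u) {suc i} {suc j} e = cong suc (lookup-injective u e)

Endpoint : Fin n → Fin n × Fin n → Set
Endpoint v (a , b) = a ≡ v ⊎ b ≡ v

shareEnd⇒ : (p q : Fin n × Fin n) → shareEnd p q ≡ true → ∃ λ v → Endpoint v p × Endpoint v q
shareEnd⇒ (a , b) (c , d) e with ∨-true⁻ {eqFin a c} e
... | inj₁ ac = a , inj₁ refl , inj₁ (sym (eqFin⇒≡ ac))
... | inj₂ e₁ with ∨-true⁻ {eqFin a d} e₁
...   | inj₁ ad = a , inj₁ refl , inj₂ (sym (eqFin⇒≡ ad))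
...   | inj₂ e₂ with ∨-true⁻ {eqFin b c} e₂
...     | inj₁ bc = b , inj₂ refl , inj₁ (sym (eqFin⇒≡ bc))
...     | inj₂ bd = b , inj₂ refl , inj₂ (sym (eqFin⇒≡ bd))

⇒shareEnd : (v : Fin n) (p q : Fin n × Fin n) → Endpoint v p → Endpoint v q → shareEnd p q ≡ true
⇒shareEnd v (a , b) (c , d) (inj₁ refl) (inj₁ refl) = ∨-trueˡ (eqFin-refl v)
⇒shareEnd v (a , b) (c , d) (inj₁ refl) (inj₂ refl) = ∨-trueʳ {eqFin a c} (∨-trueˡ (eqFin-refl v))
⇒shareEnd v (a , b) (c , d) (inj₂ refl) (inj₁ refl) = ∨-trueʳ {eqFin a c} (∨-trueʳ {eqFin a d} (∨-trueˡ (eqFin-refl v)))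
⇒shareEnd v (a , b) (c , d) (inj₂ refl) (inj₂ refl) =
  ∨-trueʳ {eqFin a c} (∨-trueʳ {eqFin a d} (∨-trueʳ {eqFin b c} (eqFin-refl v)))

module Forest {n : ℕ} (G : Graph n) (G-sym : ∀ i j → G i j ≡ G j i) (G-irrefl : ∀ i → G i i ≡ false)
              (acyclic : ¬ Cycle G) where

  adjacent⇒≢ : ∀ {u v} → G u v ≡ true → u ≢ v
  adjacent⇒≢ {u} h refl with () ← trans (sym h) (G-irrefl u)

  no-walk : (w : ℕ → Fin n) → (∀ k → G (w k) (w (suc k)) ≡ true) → ¬ (∀ k → w (suc (suc k)) ≢ w k)
  no-walk w adj nb with first-collision w
  ... | i , k , i<k , e , inj with m≤n⇒∃[o]m+o≡n i<k
  -- The repetition occurs after one step, which would be a loop, after two steps, which would turn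
  -- back, or after `3 + l` steps, which gives a cycle of that length.
  ...   | zero , refl = adjacent⇒≢ (adj i) (trans e (cong w (cong suc (+-identityʳ i))))
  ...   | suc zero , refl = nb i (trans (cong w (cong suc (trans (cong suc (sym (+-identityʳ i))) (sym (+-suc i 0))))) (sym e))
  ...   | suc (suc l) , refl = acyclic (l , c , c-inj , c-adj , c-close)
    where
    c : Fin (3 + l) → Fin n
    c x = w (i + toℕ x)
    bound : ∀ (x : Fin (3 + l)) → i + toℕ x < suc i + suc (suc l)
    bound x = ≤-trans (+-monoʳ-< i (toℕ<n x)) (≤-reflexive (+-suc i (suc (suc l))))
    c-inj : Injective _≡_ _≡_ c
    c-inj {x} {y} p = toℕ-injective (+-cancelˡ-≡ i _ _ (inj _ _ (bound x) (bound y) p))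
    c-adj : ∀ (x : Fin (2 + l)) → G (c (inject₁ x)) (c (suc x)) ≡ true
    c-adj x = trans (cong₂ G (cong (λ z → w (i + z)) (toℕ-inject₁ x)) (cong w (+-suc i (toℕ x)))) (adj (i + toℕ x))
    c-close : G (c (fromℕ (2 + l))) (c zero) ≡ true
    c-close = trans (cong₂ G (cong (λ z → w (i + z)) (toℕ-fromℕ (2 + l))) (trans (cong w (+-identityʳ i)) e)) (adj (i + (2 + l)))

  Branching : Subset n → Fin n → Set
  Branching S v = ∃ λ a → ∃ λ b → (a ∈ S × G v a ≡ true) × (b ∈ S × G v b ≡ true) × a ≢ b

  branching? : ∀ S v → Dec (Branching S v)
  branching? S v = any? λ a → any? λ b → (true? _ ×-dec true? _) ×-dec (true? _ ×-dec true? _) ×-dec ¬? (a ≟ b)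

  -- Otherwise one could walk inside S for ever without turning back.
  leaf : ∀ S u → u ∈ S → ∃ λ v → v ∈ S × ¬ Branching S v
  leaf S u uS with any? (λ v → true? (mem v S) ×-dec ¬? (branching? S v))
  ... | yes found = found
  ... | no none = ⊥-elim (no-walk w adj turn)
    where
    State : Set
    State = Fin n × ∃ λ v → v ∈ S
    advance : (s : State) → ∃ λ v → v ∈ S × G (proj₁ (proj₂ s)) v ≡ true × v ≢ proj₁ s
    advance (p , v , vS) with decidable-stable (branching? S v) (λ nb → none (v , vS , nb))
    ... | a , b , (aS , va) , (bS , vb) , a≢b with a ≟ p
    ...   | yes refl = b , bS , vb , a≢b ∘ sym
    ...   | no a≢p = a , aS , va , a≢p
    state : ℕ → State
    -- The predecessor of the start is a dummy: `turn` only looks at states after at least one step.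
    state zero = u , u , uS
    state (suc k) = proj₁ (proj₂ (state k)) , proj₁ (advance (state k)) , proj₁ (proj₂ (advance (state k)))
    w : ℕ → Fin n
    w k = proj₁ (proj₂ (state k))
    adj : ∀ k → G (w k) (w (suc k)) ≡ true
    adj k = proj₁ (proj₂ (proj₂ (advance (state k))))
    turn : ∀ k → w (suc (suc k)) ≢ w k
    turn k = proj₂ (proj₂ (proj₂ (advance (state (suc k)))))

  -- Heights come from an elimination order in which the leaf removed first is the highest. By
  -- `separates` every edge has a lower end, and by `one-lower` that end is the only possible parent
  -- of the other.
  record Heights (S : Subset n) (k : ℕ) : Set where
    field
      height : Fin n → ℕ
      bounded : ∀ v → v ∈ S → height v < k
      separates : ∀ u v → u ∈ S → v ∈ S → G u v ≡ true → height u ≢ height v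
      one-lower : ∀ v a b → v ∈ S → a ∈ S → b ∈ S → G v a ≡ true → G v b ≡ true →
                  height a < height v → height b < height v → a ≡ b

  -- A leaf `v` is removed and later given the height `k`, above all others. It is then nobody's
  -- lower neighbour, and being a leaf it has at most one lower neighbour itself.
  heights : ∀ k S → ∣ S ∣ ≤ k → Heights S k
  heights k S le with S ⊆? ∅
  ... | yes empty = record
    { height = λ _ → 0
    ; bounded = λ v vS → none v vS
    ; separates = λ u _ uS → none u uS
    ; one-lower = λ v _ _ vS → none v vS }
    where
    none : ∀ {P : Set} v → v ∈ S → P
    none v vS = contradiction (empty v vS) (∉∅ v)
  heights zero S le | no ne = contradiction le (<⇒≱ (≤-trans (s≤s z≤n) (⊊⇒∣∣< ∅ S ((λ i e → contradiction e (∉∅ i)) , ne))))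
  heights (suc k) S le | no ne with ⊈⇒∃ S ∅ ne
  ... | u , uS , _ with leaf S u uS
  ...   | v , vS , nb = record { height = h ; bounded = bnd ; separates = sep ; one-lower = one }
    where
    S′ = S ∖ singleton v
    S′⊊S : S′ ⊊ S
    S′⊊S = (λ i e → proj₁ (∈-∖⁻ S (singleton v) i e)) , λ f → proj₂ (∈-∖⁻ S (singleton v) v (f v vS)) (∈-singleton v)
    open Heights (heights k S′ (≤-pred (≤-trans (⊊⇒∣∣< S′ S S′⊊S) le))) renaming (height to h′)
    keep : ∀ x → x ∈ S → x ≢ v → x ∈ S′
    keep x xS x≢v = ∈-∖ S (singleton v) x xS λ e → x≢v (∈-singleton⁻ x v e)
    h : Fin n → ℕ
    h x with x ≟ v
    ... | yes _ = k
    ... | no _ = h′ x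
    bnd : ∀ x → x ∈ S → h x < suc k
    bnd x xS with x ≟ v
    ... | yes _ = n<1+n k
    ... | no x≢v = m<n⇒m<1+n (bounded x (keep x xS x≢v))
    sep : ∀ x y → x ∈ S → y ∈ S → G x y ≡ true → h x ≢ h y
    sep x y xS yS g with x ≟ v | y ≟ v
    ... | yes refl | yes refl = contradiction refl (adjacent⇒≢ g)
    ... | yes refl | no y≢v = <⇒≢ (bounded y (keep y yS y≢v)) ∘ sym
    ... | no x≢v | yes refl = <⇒≢ (bounded x (keep x xS x≢v))
    ... | no x≢v | no y≢v = separates x y (keep x xS x≢v) (keep y yS y≢v) g
    one : ∀ x a b → x ∈ S → a ∈ S → b ∈ S → G x a ≡ true → G x b ≡ true → h a < h x → h b < h x → a ≡ b
    one x a b xS aS bS ga gb la lb with x ≟ v | a ≟ v | b ≟ v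
    ... | yes refl | _ | _ = decidable-stable (a ≟ b) λ a≢b → nb (a , b , (aS , ga) , (bS , gb) , a≢b)
    ... | no x≢v | yes _ | _ = contradiction la (<⇒≯ (bounded x (keep x xS x≢v)))
    ... | no x≢v | no _ | yes _ = contradiction lb (<⇒≯ (bounded x (keep x xS x≢v)))
    ... | no x≢v | no a≢v | no b≢v = one-lower x a b (keep x xS x≢v) (keep a aS a≢v) (keep b bS b≢v) ga gb la lb

  open Heights (heights n full (∣p∣≤n full)) using (height) renaming (separates to separates′; one-lower to one-lower′)

  -- The edge list as a rooted forest

  private
    es : List (Fin n × Fin n)
    es = edges G

    m : ℕ
    m = length es

    L : Graph m
    L = lineGraph G

    upper : Fin n → Fin n → Bool
    upper i j = (toℕ i <ᵇ toℕ j) ∧ G i j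

    row : Fin n → List (Fin n × Fin n)
    row i = map (λ j → (i , j)) (filterᵇ (upper i) (allFin n))

  ∈-row⁻ : ∀ i {p} → p ∈ˡ row i → ∃ λ j → p ≡ (i , j) × upper i j ≡ true
  ∈-row⁻ i p∈ with ∈-map⁻ (λ j → (i , j)) p∈
  ... | j , j∈ , e = j , e , proj₂ (∈-filterᵇ⁻ (upper i) (allFin n) j∈)

  ∈-edges⁻ : ∀ {u v} → (u , v) ∈ˡ es → toℕ u < toℕ v × G u v ≡ true
  ∈-edges⁻ {u} {v} p∈ with Any.satisfied (∈-concatMap⁻ row {xs = allFin n} p∈)
  ... | i , q with ∈-row⁻ i q
  ...   | .v , refl , up with ∧-true⁻ {toℕ u <ᵇ toℕ v} up
  ...     | lt , g = <ᵇ⇒< (toℕ u) (toℕ v) (Equivalence.from T-≡ lt) , g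

  ∈-edges⁺ : ∀ {u v} → toℕ u < toℕ v → G u v ≡ true → (u , v) ∈ˡ es
  ∈-edges⁺ {u} {v} lt g = ∈-concatMap⁺ row (Any.map (λ { refl → v∈ }) (∈-allFin u))
    where
    v∈ : (u , v) ∈ˡ row u
    v∈ = ∈-map⁺ (λ j → (u , j)) (∈-filterᵇ (upper u) (∈-allFin v) (∧-true (Equivalence.to T-≡ (<⇒<ᵇ lt)) g))

  edges-unique : Unique es
  edges-unique = rows (Uniq.allFin⁺ n)
    where
    rows : ∀ {is} → Unique is → Unique (concatMap row is)
    rows [] = []
    rows {i ∷ is} (i∉ ∷ u) = Uniq.++⁺
      (Uniq.map⁺ (λ { refl → refl }) (filterᵇ-unique (upper i) (Uniq.allFin⁺ n))) (rows u) λ (p , q) → clash p q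
      where
      clash : ∀ {p} → p ∈ˡ row i → p ∈ˡ concatMap row is → ⊥
      clash p∈ q∈ with ∈-row⁻ i p∈ | find (∈-concatMap⁻ row {xs = is} q∈)
      ... | j , refl , _ | k , k∈ , q with ∈-row⁻ k q
      ...   | _ , refl , _ = All.lookup i∉ k∈ refl

  -- The edge list stores each edge with its smaller index first, whereas the orientation follows
  -- heights; hence both orders are allowed.
  Joins : Fin m → Fin n → Fin n → Set
  Joins e u v = List.lookup es e ≡ (u , v) ⊎ List.lookup es e ≡ (v , u)

  lookup-edge : ∀ e {u v} → List.lookup es e ≡ (u , v) → toℕ u < toℕ v × G u v ≡ true
  lookup-edge e eq = ∈-edges⁻ (subst (_∈ˡ es) eq (∈-lookup {xs = es} e))

  joins-unique : ∀ e f {u v} → Joins e u v → Joins f u v → e ≡ f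
  joins-unique e f (inj₁ p) (inj₁ q) = lookup-injective edges-unique (trans p (sym q))
  joins-unique e f (inj₂ p) (inj₂ q) = lookup-injective edges-unique (trans p (sym q))
  joins-unique e f (inj₁ p) (inj₂ q) = contradiction (proj₁ (lookup-edge f q)) (<⇒≯ (proj₁ (lookup-edge e p)))
  joins-unique e f (inj₂ p) (inj₁ q) = contradiction (proj₁ (lookup-edge f q)) (<⇒≯ (proj₁ (lookup-edge e p)))

  joins-adjacent : ∀ e {u v} → Joins e u v → G u v ≡ true
  joins-adjacent e (inj₁ p) = proj₂ (lookup-edge e p)
  joins-adjacent e {u} {v} (inj₂ p) = trans (G-sym u v) (proj₂ (lookup-edge e p))

  join : ∀ u v → G u v ≡ true → ∃ λ e → Joins e u v
  join u v g with <-cmp (toℕ u) (toℕ v)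
  ... | tri< lt _ _ = let i = ∈-edges⁺ lt g in Any.index i , inj₁ (sym (lookup-index i))
  ... | tri≈ _ eq _ = contradiction (toℕ-injective eq) (adjacent⇒≢ g)
  ... | tri> _ _ gt = let i = ∈-edges⁺ gt (trans (G-sym v u) g) in Any.index i , inj₂ (sym (lookup-index i))

  orient : ∀ e → ∃ λ c → ∃ λ p → Joins e c p × height p < height c
  orient e with List.lookup es e in eq
  ... | u , v with <-cmp (height u) (height v)
  ...   | tri< lt _ _ = v , u , inj₂ refl , lt
  ...   | tri≈ _ h≡ _ = contradiction h≡ (separates′ u v (∈full u) (∈full v) (proj₂ (lookup-edge e eq)))
  ...   | tri> _ _ gt = u , v , inj₁ refl , gt

  childOf parentOf : Fin m → Fin n
  childOf e = proj₁ (orient e)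
  parentOf e = proj₁ (proj₂ (orient e))

  joins-oriented : ∀ e → Joins e (childOf e) (parentOf e)
  joins-oriented e = proj₁ (proj₂ (proj₂ (orient e)))

  oriented-lower : ∀ e → height (parentOf e) < height (childOf e)
  oriented-lower e = proj₂ (proj₂ (proj₂ (orient e)))

  -- Two edges with the same child lead to lower neighbours of one vertex. These coincide by
  -- `one-lower`, and the graph has no parallel edges.
  childOf-injective : Injective _≡_ _≡_ childOf
  childOf-injective {e} {f} eq = joins-unique e f (joins-oriented e)
    (subst₂ (Joins f) (sym eq) (sym parents≡) (joins-oriented f))
    where
    parents≡ : parentOf e ≡ parentOf f
    parents≡ = one-lower′ (childOf e) (parentOf e) (parentOf f) (∈full (childOf e)) (∈full (parentOf e)) (∈full (parentOf f))
      (joins-adjacent e (joins-oriented e))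
      (subst (λ c → G c (parentOf f) ≡ true) (sym eq) (joins-adjacent f (joins-oriented f)))
      (oriented-lower e) (subst (λ c → height (parentOf f) < height c) (sym eq) (oriented-lower f))

  forest : RootedForest n m
  forest = record
    { child = childOf ; parent = parentOf ; child-injective = childOf-injective
    ; height = height ; parent-lower = oriented-lower }

  open Rooted forest

  -- Comparison of the two generating functions

  joins-ends : ∀ e {u v a b} → Joins e u v → Joins e a b → (a ≡ u × b ≡ v) ⊎ (a ≡ v × b ≡ u)
  joins-ends e (inj₁ p) (inj₁ q) with refl ← trans (sym p) q = inj₁ (refl , refl)
  joins-ends e (inj₁ p) (inj₂ q) with refl ← trans (sym p) q = inj₂ (refl , refl)
  joins-ends e (inj₂ p) (inj₁ q) with refl ← trans (sym p) q = inj₂ (refl , refl)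
  joins-ends e (inj₂ p) (inj₂ q) with refl ← trans (sym p) q = inj₁ (refl , refl)

  eulerG : ∀ U → comps G U + ∣ edgesIn U ∣ ≡ ∣ U ∣
  eulerG = euler-vertices G G-sym (λ e → joins-adjacent e (joins-oriented e))
    λ u v g → let (e , j) = join u v g in e , joins-ends e j (joins-oriented e)

  end⇒endpoint : ∀ v e → End v e → Endpoint v (List.lookup es e)
  end⇒endpoint v e = match (joins-oriented e)
    where
    match : ∀ {p c d} → p ≡ (c , d) ⊎ p ≡ (d , c) → c ≡ v ⊎ d ≡ v → Endpoint v p
    match (inj₁ refl) end = end
    match (inj₂ refl) end = swap end

  endpoint⇒end : ∀ v e → Endpoint v (List.lookup es e) → End v e
  endpoint⇒end v e = match (joins-oriented e)
    where
    match : ∀ {p c d} → p ≡ (c , d) ⊎ p ≡ (d , c) → Endpoint v p → c ≡ v ⊎ d ≡ v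
    match (inj₁ refl) end = end
    match (inj₂ refl) end = swap end

  L-share : ∀ e f → L e f ≡ true → ∃ λ v → End v e × End v f
  L-share e f l with shareEnd⇒ _ _ (proj₂ (∧-true⁻ {not (eqFin e f)} l))
  ... | v , a , b = v , endpoint⇒end v e a , endpoint⇒end v f b

  share-L : ∀ e f v → e ≢ f → End v e → End v f → L e f ≡ true
  share-L e f v e≢f a b = ∧-true (not-true λ eq → e≢f (eqFin⇒≡ eq)) (⇒shareEnd v _ _ (end⇒endpoint v e a) (end⇒endpoint v f b))

  L-flip : ∀ e f → L e f ≡ true → L f e ≡ true
  L-flip e f l with L-share e f l
  ... | v , a , b = share-L f e v (λ { refl → not-true⁻ (proj₁ (∧-true⁻ {not (eqFin e e)} l)) (eqFin-refl e) }) b a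

  eulerL : ∀ M → comps L M + ∣ M ∣ ≡ ∣ ends M ∣
  eulerL = euler-edges L (λ e f → true-ext (L-flip e f) (L-flip f e)) L-share share-L

  edgesIn-full : edgesIn full ≡ full
  edgesIn-full = ⊆-antisym _ full (λ e _ → ∈full e) λ e _ → ∈-edgesIn full e (∈full (childOf e)) (∈full (parentOf e))

  -- The count of components at `full`, where all edges lie inside. It gives both polytopes the same
  -- dimension.
  dimNesto≡ : dimNesto G ≡ m
  dimNesto≡ = begin
    n ∸ numMax G                                      ≡⟨ cong₂ _∸_ (sym (∣⊤∣≡n n)) (numMax≡comps G) ⟩
    ∣ full {n} ∣ ∸ comps G full                       ≡⟨ cong (_∸ comps G full) (eulerG full) ⟨
    (comps G full + ∣ edgesIn full ∣) ∸ comps G full  ≡⟨ m+n∸m≡n (comps G full) _ ⟩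
    ∣ edgesIn full ∣                                  ≡⟨ cong ∣_∣ edgesIn-full ⟩
    ∣ full {m} ∣                                      ≡⟨ ∣⊤∣≡n m ⟩
    m                                                 ∎
    where open ≡-Reasoning

  module _ (t : ℕ) where

    D : Subset n → ℕ
    D = fromEdges t (comps G) (comps L) edgesIn ends galois eulerG eulerL (genNesto L t) (genNesto-recursive L t)

    -- The initial value for `recursive-unique`: no edge lies inside `∅`, so only the empty edge set
    -- contributes, with weight 1.
    D-∅ : D ∅ ≡ 1
    D-∅ = trans (∑-ext (allSubsets m) λ M → cong (λ b → ⟦ b ⟧ * weight M) (only-∅ M)) (trans (∑-delta-subset weight ∅)
      (cong₂ _*_ (cong ((1 + t) ^_) codim≡0′) (cong₂ _*_ (cong (t ^_) (comps-∅ L)) (genNesto-∅ L t))))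
      where
      weight : Subset m → ℕ
      weight M = (1 + t) ^ codim (edgesIn ∅) M * (t ^ comps L M * genNesto L t M)
      edgesIn-∅ : edgesIn ∅ ≡ ∅
      edgesIn-∅ = ⊆-antisym _ ∅ (λ e e∈ → contradiction (proj₁ (∈-edgesIn⁻ ∅ e e∈)) (∉∅ (childOf e))) λ e e∈ → contradiction e∈ (∉∅ e)
      only-∅ : ∀ M → (M ⊆ᵇ edgesIn ∅) ≡ (∅ ≐ᵇ M)
      only-∅ M = trans (cong (M ⊆ᵇ_) edgesIn-∅) (sym (cong (_∧ (M ⊆ᵇ ∅)) (⊆ᵇ-true ∅ M λ i e → contradiction e (∉∅ i))))
      codim≡0′ : codim (edgesIn ∅) ∅ ≡ 0
      codim≡0′ = +-cancelʳ-≡ ∣ ∅ {m} ∣ _ 0 (trans (cong (λ X → codim X ∅ + ∣ ∅ {m} ∣) edgesIn-∅) (codim+∣∣ ∅ ∅ (⊆-refl {m} ∅)))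

    genNesto≡D : ∀ U → genNesto G t U ≡ D U
    genNesto≡D = recursive-unique t (genNesto-recursive G t)
      (fromEdges-recursive t (comps G) (comps L) edgesIn ends galois eulerG eulerL (genNesto L t) (genNesto-recursive L t))
      base
      where
      base : ∀ U → comps G U ≡ 0 → genNesto G t U ≡ D U
      base U e with refl ← comps≡0⇒∅ G U e = trans (genNesto-∅ G t) (sym D-∅)

    genfun : ∑ (sublists (allSubsets n)) (λ N → ⟦ isNested G N ⟧ * t ^ length N)
           ≡ ∑ (extPairs L) (λ p → ⟦ isExtNested L (proj₁ p) (proj₂ p) ⟧ * t ^ extSize L p)
    genfun = begin
      ∑ (sublists (allSubsets n)) (λ N → ⟦ isNested G N ⟧ * t ^ length N)
        ≡⟨ ∑-isNested G t ⟩
      genNesto G t full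
        ≡⟨ genNesto≡D full ⟩
      D full
        ≡⟨ ∑-ext (allSubsets m) (λ M → trans
             (cong (λ X → ⟦ M ⊆ᵇ X ⟧ * ((1 + t) ^ codim X M * (t ^ comps L M * genNesto L t M))) edgesIn-full)
             (trans (cong (λ b → ⟦ b ⟧ * ((1 + t) ^ codim full M * (t ^ comps L M * genNesto L t M))) (⊆ᵇ-true M full λ i _ → ∈full i))
               (+-identityʳ _))) ⟩
      ∑ (allSubsets m) (λ M → (1 + t) ^ codim full M * (t ^ comps L M * genNesto L t M))
        ≡⟨ ∑-isExtNested L t ⟨
      ∑ (extPairs L) (λ p → ⟦ isExtNested L (proj₁ p) (proj₂ p) ⟧ * t ^ extSize L p) ∎
      where open ≡-Reasoning

  fNesto≡fExt : ∀ i → fNesto G i ≡ fExt L i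
  fNesto≡fExt i = trans
    (cong (λ d → countᵇ (λ N → isNested G N ∧ (length N + i ≡ᵇ d)) (sublists (allSubsets n))) dimNesto≡)
    (genfun-count (isNested G) length (sublists (allSubsets n))
      (λ p → isExtNested L (proj₁ p) (proj₂ p)) (extSize L) (extPairs L) genfun m i)

hCoeff-cong : ∀ d {f g : ℕ → ℕ} → (∀ j → f j ≡ g j) → ∀ i → hCoeff d f i ≡ hCoeff d g i
hCoeff-cong d e i = cong sumℤ (map-cong
  (λ j → cong (λ k → if i ≤ᵇ j then signed (j ∸ i) (ℤ.+ ((j Comb.C i) * k)) else ℤ.+ 0) (e j)) (upTo (suc d)))

theorem5p14 : (n : ℕ) (G : Graph n) → IsForest G →
    (i : ℕ) → hNesto G i ≡ hExt (lineGraph G) i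
theorem5p14 n G ((G-sym , G-irrefl) , acyclic) i = trans
  (cong (λ d → hCoeff d (fNesto G) i) dimNesto≡)
  (hCoeff-cong (length (edges G)) fNesto≡fExt i)
  where open Forest G G-sym G-irrefl acyclic
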